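{- If $T$ is a rooted tree with root $r$, then the algorithm "ESI-number of a tree" (described in the context) computes $\alpha_{\rm es}(T)$ in $O(n(T))$ time and $O(n(T))$ space.
   Context: All graphs are finite and simple; $n(T)$ is the number of vertices of $T$. For $B\subseteq V(G)$, $N[B]=\bigcup_{b\in B}N[b]$ and $N(B)=N[B]- B$. A set $B\subseteq V(G)$ is an externally supported independence set (ESI-set) if $B$ is independent and every $v\in N(B)$ has a neighbor in $V(G)- N[B]$ (the empty set is an ESI-set); $\alpha_{\rm es}(G)$ is the maximum cardinality of an ESI-set of $G$. For a rooted tree $T$ and $v\in V(T)$, $Ch(v)$ is the set of children of $v$ and $T_v$ the subtree rooted at $v$. Relative to a set $B$, a vertex $v$ has type $S$ if $v\in B$, type $N$ if $v\in N(B)$ and type $R$ if $v\in V(T)-N[B]$. The table entry $DP[v][x][p]$, with $x,p\in\{S,N,R\}$, is intended to be the maximum number of vertices of type $S$ in $T_v$ subject to $v$ having type $x$ and its parent having type $p$; impossible states have value $-\infty$ (and a maximum over no feasible assignment is $-\infty$). Algorithm "ESI-number of a tree". Input: a rooted tree $T$ with root $r$. Compute a postorder ordering of the vertices. For every $v$ in postorder compute: (A) ($v$ has type $S$) $DP[v][S][N] = 1+\sum_{u\in Ch(v)} DP[u][N][S]$. (B) ($v$ has type $R$) for each $p\in\{N,R\}$: $DP[v][R][p]=\sum_{u\in Ch(v)}\max\{DP[u][N][R],\,DP[u][R][R]\}$. (C) ($v$ has type $N$) for each $p\in\{S,N,R\}$: $DP[v][N][p]=\max\sum_{u\in Ch(v)}DP[u][x_u][N]$,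 where the maximum is over all assignments $(x_u)_{u\in Ch(v)}$ with $x_u\in\{S,N,R\}$ such that: if $p\neq S$ then at least one child $u$ has $x_u=S$; and if $p\neq R$ then at least one child $u$ has $x_u=R$. Return $\max\{DP[r][S][N],\,DP[r][N][N],\,DP[r][R][N]\}$. -}

module Defs where

open import Data.Bool.Base using (Bool; true; false; if_then_else_)
open import Data.Fin using (Fin; toℕ; #_; combine; _↑ʳ_)
import Data.Fin.Properties as Fin
open import Data.Fin.Subset using (Subset; _∈_; ∣_∣)
open import Data.List.Base
  using (List; []; _∷_; _++_; _∷ʳ_; map; concatMap; foldr; filter; allFin; applyUpTo)
open import Data.List.Membership.DecPropositional using () renaming (_∈?_ to mem?)
open import Data.List.Membership.Propositional using () renaming (_∈_ to _∈ˡ_)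
open import Data.List.Relation.Binary.Permutation.Propositional using (_↭_)
open import Data.List.Relation.Unary.Any using (Any; any?)
open import Data.List.Relation.Unary.Unique.Propositional using (Unique)
open import Data.Nat.Base using (ℕ; zero; suc; _+_; _∸_; _⊔_; _≤_; _<_; _≡ᵇ_)
open import Data.Product.Base using (Σ-syntax; ∃-syntax; _×_; _,_; proj₁; proj₂)
open import Data.Sum.Base using (_⊎_)
open import Data.Vec.Functional using (Vector; updateAt)
open import Level using (0ℓ)
open import Relation.Binary.Construct.Closure.ReflexiveTransitive using (Star; ε; _◅_)
open import Relation.Binary.Core using (Rel)
open import Relation.Binary.Definitions using (Decidable; DecidableEquality; Symmetric)
open import Relation.Binary.PropositionalEquality using (_≡_; _≢_; refl)
open import Relation.Nullary using (¬_; Dec; yes; no; ¬?; _×-dec_; _→-dec_)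
open import Relation.Nullary.Construct.Add.Infimum using (_₋; ⊥₋; [_])

record Graph (n : ℕ) : Set₁ where
  field
    Adj       : Rel (Fin n) 0ℓ
    adj?      : Decidable Adj
    symmetric : Symmetric Adj
    loopless  : ∀ v → ¬ Adj v v

module _ {n : ℕ} (G : Graph n) where
  open Graph G

  _∈N[_] : Fin n → Subset n → Set
  v ∈N[ B ] = ∃[ b ] b ∈ B × (v ≡ b ⊎ Adj b v)

  _∈N⟨_⟩ : Fin n → Subset n → Set
  v ∈N⟨ B ⟩ = v ∈N[ B ] × ¬ v ∈ B

  Independent : Subset n → Set
  Independent B = ∀ u v → u ∈ B → v ∈ B → ¬ Adj u v

  IsESI : Subset n → Set
  IsESI B = Independent B × (∀ v → v ∈N⟨ B ⟩ → ∃[ w ] Adj v w × ¬ w ∈N[ B ])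

  IsESINumber : ℕ → Set
  IsESINumber k = (∃[ B ] IsESI B × ∣ B ∣ ≡ k) × (∀ B → IsESI B → ∣ B ∣ ≤ k)

  Walk : Fin n → Fin n → Set
  Walk = Star Adj

  vertices : ∀ {u v} → Walk u v → List (Fin n)
  vertices {u} ε       = u ∷ []
  vertices {u} (_ ◅ w) = u ∷ vertices w

  edgeCount : ∀ {u v} → Walk u v → ℕ
  edgeCount ε       = 0
  edgeCount (_ ◅ w) = suc (edgeCount w)

  Path : Fin n → Fin n → Set
  Path u v = Σ[ w ∈ Walk u v ] Unique (vertices w)

  -- A cycle is a path with at least two edges closed up by one more edge.
  record IsTree : Set where
    field
      connected : ∀ u v → Path u v
      acyclic   : ∀ {u v} (p : Path u v) → 2 ≤ edgeCount (proj₁ p) → ¬ Adj v u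

record RootedTree (n : ℕ) : Set₁ where
  field
    graph  : Graph n
    isTree : IsTree graph
    root   : Fin n
  open Graph graph public
  open IsTree isTree public

  rootPath : ∀ v → List (Fin n)
  rootPath v = vertices graph (proj₁ (connected root v))

  -- u is a child of v when u is a neighbour of v off the root–v path,
  -- which is unique in a tree.
  IsChildOf : Fin n → Fin n → Set
  IsChildOf u v = Adj v u × ¬ u ∈ˡ rootPath v

  isChildOf? : Decidable IsChildOf
  isChildOf? u v = adj? v u ×-dec ¬? (mem? Fin._≟_ u (rootPath v))

  children : Fin n → List (Fin n)
  children v = filter (λ u → isChildOf? u v) (allFin n)

module _ {n : ℕ} (T : RootedTree n) where
  open RootedTree T

  mutual
    -- Siblings may be visited in any order.
    data Postorder : Fin n → List (Fin n) → Set where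
      visit : ∀ {v us xs} → us ↭ children v → Postorders us xs → Postorder v (xs ∷ʳ v)

    data Postorders : List (Fin n) → List (Fin n) → Set where
      []  : Postorders [] []
      _∷_ : ∀ {u us xs ys} → Postorder u xs → Postorders us ys →
            Postorders (u ∷ us) (xs ++ ys)

data Type : Set where
  S N R : Type

_≟_ : DecidableEquality Type
S ≟ S = yes refl
S ≟ N = no λ ()
S ≟ R = no λ ()
N ≟ S = no λ ()
N ≟ N = yes refl
N ≟ R = no λ ()
R ≟ S = no λ ()
R ≟ N = no λ ()
R ≟ R = yes refl

infixl 6 _⊹_

-- In ℕ ₋ the added point ⊥₋ is -∞.
_⊹_ : ℕ ₋ → ℕ ₋ → ℕ ₋
⊥₋    ⊹ _     = ⊥₋
[ _ ] ⊹ ⊥₋    = ⊥₋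
[ a ] ⊹ [ b ] = [ a + b ]

max : ℕ ₋ → ℕ ₋ → ℕ ₋
max ⊥₋    y     = y
max [ a ] ⊥₋    = [ a ]
max [ a ] [ b ] = [ a ⊔ b ]

sumOf : {A : Set} → (A → ℕ ₋) → List A → ℕ ₋
sumOf f xs = foldr _⊹_ [ 0 ] (map f xs)

maximum : List (ℕ ₋) → ℕ ₋
maximum = foldr max ⊥₋

Assignment : Set → Set
Assignment V = List (V × Type)

assignments : {V : Set} → List V → List (Assignment V)
assignments []       = [] ∷ []
assignments (u ∷ us) =
  concatMap (λ x → map ((u , x) ∷_) (assignments us)) (S ∷ N ∷ R ∷ [])

Uses : {V : Set} → Type → Assignment V → Set
Uses x = Any (λ ux → proj₂ ux ≡ x)

Admissible : {V : Set} → Type → Assignment V → Set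
Admissible p a = (p ≢ S → Uses S a) × (p ≢ R → Uses R a)

uses? : {V : Set} (x : Type) (a : Assignment V) → Dec (Uses x a)
uses? x = any? (λ ux → proj₂ ux ≟ x)

admissible? : {V : Set} (p : Type) (a : Assignment V) → Dec (Admissible p a)
admissible? p a = (¬? (p ≟ S) →-dec uses? S a) ×-dec (¬? (p ≟ R) →-dec uses? R a)

Table : ℕ → Set
Table n = Fin n → Type → Type → ℕ ₋

record IsDPTable {n : ℕ} (T : RootedTree n) (DP : Table n) : Set where
  open RootedTree T
  field
    typeS : ∀ v → DP v S N ≡ [ 1 ] ⊹ sumOf (λ u → DP u N S) (children v)
    typeR : ∀ v p → p ≡ N ⊎ p ≡ R →
            DP v R p ≡ sumOf (λ u → max (DP u N R) (DP u R R)) (children v)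
    typeN : ∀ v p →
            DP v N p ≡ maximum (map (sumOf (λ ux → DP (proj₁ ux) (proj₂ ux) N))
                                    (filter (admissible? p) (assignments (children v))))
    impossible : ∀ v → DP v S S ≡ ⊥₋ × DP v S R ≡ ⊥₋ × DP v R S ≡ ⊥₋

output : ∀ {n} → RootedTree n → Table n → ℕ ₋
output T DP = max (DP root S N) (max (DP root N N) (DP root R N))
  where open RootedTree T

-- A random access machine whose memory consists of k arrays of words.
module Machine (k : ℕ) where

  State : Set
  State = Vector (ℕ → ℕ) k

  write : Fin k → ℕ → ℕ → State → State
  write a i x σ = updateAt σ a (λ row j → if j ≡ᵇ i then x else row j)

  infix  9 _⟨_⟩
  infixl 6 _⊕_ _⊖_
  infix  5 _⁇_∶_
  infix  4 _⟨_⟩≔_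
  infixr 3 _⨾_

  data Expr : Set where
    lit     : ℕ → Expr
    _⟨_⟩    : Fin k → Expr → Expr
    _⊕_ _⊖_ : Expr → Expr → Expr
    _⁇_∶_   : Expr → Expr → Expr → Expr

  data Stmt : Set where
    _⟨_⟩≔_ : Fin k → Expr → Expr → Stmt
    _⨾_    : Stmt → Stmt → Stmt
    while  : Expr → Stmt → Stmt

  branch : ∀ {ℓ} {A : Set ℓ} → ℕ → A → A → A
  branch zero    x y = y
  branch (suc _) x y = x

  ⟦_⟧ : Expr → State → ℕ
  ⟦ lit x ⟧     σ = x
  ⟦ a ⟨ e ⟩ ⟧   σ = σ a (⟦ e ⟧ σ)
  ⟦ e ⊕ f ⟧     σ = ⟦ e ⟧ σ + ⟦ f ⟧ σ
  ⟦ e ⊖ f ⟧     σ = ⟦ e ⟧ σ ∸ ⟦ f ⟧ σ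
  ⟦ e ⁇ f ∶ g ⟧ σ = branch (⟦ e ⟧ σ) (⟦ f ⟧ σ) (⟦ g ⟧ σ)

  -- Every intermediate value, in particular each address that is
  -- read, is below M.
  Fits : ℕ → State → Expr → Set
  Fits M σ (lit x)       = x < M
  Fits M σ (a ⟨ e ⟩)     = Fits M σ e × ⟦ a ⟨ e ⟩ ⟧ σ < M
  Fits M σ (e ⊕ f)       = Fits M σ e × Fits M σ f × ⟦ e ⊕ f ⟧ σ < M
  Fits M σ (e ⊖ f)       = Fits M σ e × Fits M σ f
  Fits M σ (e ⁇ f ∶ g)   = Fits M σ e × branch (⟦ e ⟧ σ) (Fits M σ f) (Fits M σ g)

  -- The number of operations; both branches of a conditional are charged.
  cost : Expr → ℕ
  cost (lit _)     = 1
  cost (a ⟨ e ⟩)   = 1 + cost e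
  cost (e ⊕ f)     = 1 + cost e + cost f
  cost (e ⊖ f)     = 1 + cost e + cost f
  cost (e ⁇ f ∶ g) = 1 + cost e + cost f + cost g

  -- Exec M s σ σ′ t: started in σ, the statement s halts in σ′ after t steps,
  -- accessing only the first M cells of each array and handling only numbers
  -- below M.  So the run takes place in k * M words of memory, each of
  -- O(log M) bits.
  data Exec (M : ℕ) : Stmt → State → State → ℕ → Set where
    assign : ∀ {a e f σ} → Fits M σ e → Fits M σ f →
             Exec M (a ⟨ e ⟩≔ f) σ (write a (⟦ e ⟧ σ) (⟦ f ⟧ σ) σ) (1 + cost e + cost f)
    seq    : ∀ {s₁ s₂ σ₀ σ₁ σ₂ t₁ t₂} → Exec M s₁ σ₀ σ₁ t₁ → Exec M s₂ σ₁ σ₂ t₂ →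
             Exec M (s₁ ⨾ s₂) σ₀ σ₂ (t₁ + t₂)
    stop   : ∀ {e s σ} → Fits M σ e → ⟦ e ⟧ σ ≡ 0 →
             Exec M (while e s) σ σ (1 + cost e)
    loop   : ∀ {e s σ₀ σ₁ σ₂ t₁ t₂} → Fits M σ₀ e → ⟦ e ⟧ σ₀ ≢ 0 →
             Exec M s σ₀ σ₁ t₁ → Exec M (while e s) σ₁ σ₂ t₂ →
             Exec M (while e s) σ₀ σ₂ (1 + cost e + t₁ + t₂)

open Machine 26 public

Array : Set
Array = Fin 26

-- The input: single cells for the number of vertices and the root, and the
-- arrays of the linked child lists.
size root first next : Array
size  = # 0
root  = # 1
first = # 2
next  = # 3

order stack : Array
order = # 4
stack = # 5

-- Single cells.
top idx cur ptr kid acc result : Array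
top    = # 6
idx    = # 7
cur    = # 8
ptr    = # 9
kid    = # 10
acc    = # 11
result = # 12

-- best s r holds the maximum of Σ DP[u][x_u][N] over the assignments to the
-- children u scanned so far that use S if s is true and use R if r is true.
best : Bool → Bool → Array
best false false = # 13
best false true  = # 14
best true  false = # 15
best true  true  = # 16

tag : Type → Fin 3
tag S = # 0
tag N = # 1
tag R = # 2

dp : Type → Type → Array
dp x p = 17 ↑ʳ combine (tag x) (tag p)

-- A word represents an element of ℕ ∪ {-∞}: 0 stands for -∞, suc a for a.
decode : ℕ → ℕ ₋
decode zero    = ⊥₋
decode (suc a) = [ a ]

-∞ : Expr
-∞ = lit 0

⌜_⌝ : ℕ → Expr
⌜ a ⌝ = lit (suc a)

infixl 6 _⊞_

_⊞_ : Expr → Expr → Expr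
e ⊞ f = e ⁇ (f ⁇ ((e ⊕ f) ⊖ lit 1) ∶ -∞) ∶ -∞

maxᵉ : Expr → Expr → Expr
maxᵉ e f = e ⊕ (f ⊖ e)

var : Array → Expr
var a = a ⟨ lit 0 ⟩

infix 4 _≔_

_≔_ : Array → Expr → Stmt
a ≔ e = a ⟨ lit 0 ⟩≔ e

DP[_][_][_] : Array → Type → Type → Expr
DP[ v ][ x ][ p ] = dp x p ⟨ var v ⟩

DP[_][_][_]≔_ : Array → Type → Type → Expr → Stmt
DP[ v ][ x ][ p ]≔ e = dp x p ⟨ var v ⟩≔ e

infix 4 DP[_][_][_]≔_

-- Runs s with kid set to each child of cur in turn.
forChildren : Stmt → Stmt
forChildren s =
  ptr ≔ first ⟨ var cur ⟩ ⨾
  while (var ptr)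
    ( kid ≔ var ptr ⊖ lit 1 ⨾
      s ⨾
      ptr ≔ next ⟨ var kid ⟩ )

-- Depth-first search that fills the array order from its end; a preorder read
-- backwards is a postorder.
computePostorder : Stmt
computePostorder =
  stack ⟨ lit 0 ⟩≔ var root ⨾
  top ≔ lit 1 ⨾
  idx ≔ var size ⨾
  while (var top)
    ( top ≔ var top ⊖ lit 1 ⨾
      cur ≔ stack ⟨ var top ⟩ ⨾
      idx ≔ var idx ⊖ lit 1 ⨾
      order ⟨ var idx ⟩≔ var cur ⨾
      forChildren
        ( stack ⟨ var top ⟩≔ var kid ⨾
          top ≔ var top ⊕ lit 1 ) )

computeS : Stmt
computeS =
  acc ≔ ⌜ 1 ⌝ ⨾
  forChildren (acc ≔ var acc ⊞ DP[ kid ][ N ][ S ]) ⨾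
  DP[ cur ][ S ][ N ]≔ var acc ⨾
  DP[ cur ][ S ][ S ]≔ -∞ ⨾
  DP[ cur ][ S ][ R ]≔ -∞

computeR : Stmt
computeR =
  acc ≔ ⌜ 0 ⌝ ⨾
  forChildren (acc ≔ var acc ⊞ maxᵉ DP[ kid ][ N ][ R ] DP[ kid ][ R ][ R ]) ⨾
  DP[ cur ][ R ][ N ]≔ var acc ⨾
  DP[ cur ][ R ][ R ]≔ var acc ⨾
  DP[ cur ][ R ][ S ]≔ -∞

-- The type of kid is chosen; choosing S or R discharges that requirement for
-- the children scanned before.
extend : Bool → Bool → Stmt
extend s r =
  best s r ≔ maxᵉ (var (best false r) ⊞ DP[ kid ][ S ][ N ])
            (maxᵉ (var (best s     r) ⊞ DP[ kid ][ N ][ N ])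
                  (var (best s false) ⊞ DP[ kid ][ R ][ N ]))

-- The four updates are in place: each one reads, besides the cell it
-- overwrites, only cells with fewer requirements, which come later.
computeN : Stmt
computeN =
  best false false ≔ ⌜ 0 ⌝ ⨾
  best false true  ≔ -∞ ⨾
  best true  false ≔ -∞ ⨾
  best true  true  ≔ -∞ ⨾
  forChildren
    ( extend true  true ⨾
      extend true  false ⨾
      extend false true ⨾
      extend false false ) ⨾
  DP[ cur ][ N ][ S ]≔ var (best false true) ⨾
  DP[ cur ][ N ][ N ]≔ var (best true  true) ⨾
  DP[ cur ][ N ][ R ]≔ var (best true  false)

computeTable : Stmt
computeTable =
  idx ≔ lit 0 ⨾
  while (var size ⊖ var idx)
    ( cur ≔ order ⟨ var idx ⟩ ⨾
      computeS ⨾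
      computeR ⨾
      computeN ⨾
      idx ≔ var idx ⊕ lit 1 )

esiNumberOfTree : Stmt
esiNumberOfTree =
  computePostorder ⨾
  computeTable ⨾
  result ≔ maxᵉ DP[ root ][ S ][ N ] (maxᵉ DP[ root ][ N ][ N ] DP[ root ][ R ][ N ])

-- Linked nxt x us: starting from x and following nxt, where suc u points to
-- the vertex u and 0 is the null pointer, one meets exactly the vertices us.
data Linked {n : ℕ} (nxt : ℕ → ℕ) : ℕ → List (Fin n) → Set where
  []  : Linked nxt 0 []
  _∷_ : ∀ u {us} → Linked nxt (nxt (toℕ u)) us → Linked nxt (suc (toℕ u)) (u ∷ us)

-- The children of each vertex may be listed in any order, and nothing is
-- assumed about the other cells.
record Holds {n : ℕ} (σ : State) (T : RootedTree n) : Set where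
  field
    sizeCell   : σ size 0 ≡ n
    rootCell   : σ root 0 ≡ toℕ (RootedTree.root T)
    childLists : ∀ v → ∃[ us ] us ↭ RootedTree.children T v ×
                               Linked (σ next) (σ first (toℕ v)) us

tableIn : ∀ {n} → State → Table n
tableIn σ v x p = decode (σ (dp x p) (toℕ v))

record Completed {n : ℕ} (T : RootedTree n) (σ : State) : Set where
  field
    postorder : ∃[ vs ] Postorder T (RootedTree.root T) vs ×
                        applyUpTo (σ order) n ≡ map toℕ vs
    table     : IsDPTable T (tableIn σ)
    returned  : decode (σ result 0) ≡ output T (tableIn σ)

{-# OPTIONS --safe #-}
module Submission where

-- Labelling every vertex of T by its type turns ESI-sets B into labellings in
-- which the neighbours of an S are N, no neighbour of an R is S, and every N
-- has a neighbour S and a neighbour R.  These conditions are local to a vertex,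
-- its parent and its children, so the recurrences compute the largest number
-- of S over the labellings of each subtree.
--
-- The machine is analysed with triples whose time bound is a constant of the
-- program times the number of loop iterations; depth-first search and the
-- table computation both spend one iteration per vertex and one per edge.
-- DP[v][x][p] is at most the size of the subtree of v, so all words are O(n).

open import Defs
open import Data.Bool.Base using (Bool; true; false; if_then_else_; _∨_; T)
open import Data.Empty using (⊥; ⊥-elim)
open import Data.Fin using (Fin; toℕ)
import Data.Fin.Properties as Fin
open import Data.Fin.Subset using (Subset; ∣_∣) renaming (_∈_ to _∈ₛ_)
open import Data.Fin.Subset.Properties using () renaming (_∈?_ to _∈ₛ?_)
open import Data.List.Base
  using (List; []; _∷_; _++_; _∷ʳ_; _ʳ++_; map; concat; concatMap; filter; foldl; length; lookup; allFin; applyUpTo)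
import Data.List.Base as List
open import Data.List.Membership.DecPropositional using () renaming (_∈?_ to mem?)
open import Data.List.Membership.Propositional using (_∈_)
open import Data.List.Membership.Propositional.Properties
  using (∈-++⁺ˡ; ∈-++⁺ʳ; ∈-++⁻; ∈-lookup; ∈-length; ∈-allFin; ∈-map⁺; ∈-map⁻;
         ∈-filter⁺; ∈-filter⁻; ∈-concatMap⁺; ∈-concatMap⁻)
open import Data.List.Membership.Propositional.Properties.WithK using (unique∧set⇒bag)
open import Data.List.Properties
  using (∷-injectiveˡ; ∷ʳ-injective; length-++; length-ʳ++; length-tabulate; map-++; map-∘; map-id;
         map-tabulate; map-cong; map-cong-local; ++-assoc; ++-cancelˡ; ++-identityʳ)
open import Data.List.Relation.Binary.BagAndSetEquality using (∼bag⇒↭)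
open import Data.List.Relation.Binary.Permutation.Propositional
  using (_↭_; prep; swap; ↭-sym; ↭⇒↭ₛ) renaming (refl to ↭-refl; trans to ↭-trans)
open import Data.List.Relation.Binary.Permutation.Propositional.Properties
  using (Any-resp-↭; ∈-resp-↭; ↭-length; ↭-map-inv) renaming (map⁺ to ↭-map⁺)
import Data.List.Relation.Binary.Permutation.Setoid.Properties as PermSetoid
open import Data.List.Relation.Unary.All using (All; []; _∷_) renaming (lookup to lookupAll; tabulate to tabulateAll)
open import Data.List.Relation.Unary.All.Properties using (++⁻ˡ; ++⁻ʳ)
open import Data.List.Relation.Unary.AllPairs using ([]; _∷_)
open import Data.List.Relation.Unary.Any using (Any; here; there; satisfied)
open import Data.List.Relation.Unary.Unique.Propositional using (Unique)
open import Data.List.Relation.Unary.Unique.Propositional.Properties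
  using (allFin⁺; filter⁺) renaming (++⁺ to unique-++⁺)
open import Data.Nat.Base using (ℕ; zero; suc; _+_; _*_; _∸_; _⊔_; _≤_; _<_; _≡ᵇ_; z≤n; s≤s)
open import Data.Nat.ListAction using (sum)
open import Data.Nat.ListAction.Properties using (sum-++; sum-↭)
import Data.Nat.Properties as ℕ
open import Data.Product.Base using (Σ-syntax; ∃-syntax; _×_; _,_; proj₁; proj₂)
open import Data.Sum.Base using (_⊎_; inj₁; inj₂)
open import Data.Unit.Base using (⊤; tt)
import Data.Vec.Base as Vec
open import Data.Vec.Functional.Properties using (updateAt-minimal)
open import Data.Vec.Properties using (lookup∘tabulate; []=⇒lookup; lookup⇒[]=)
open import Function.Base using (_∘_)
open import Function.Bundles using (mk⇔)
open import Relation.Binary.Construct.Add.Infimum.NonStrict _≤_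
  using (_≤₋_; ⊥₋≤_; [_]; [≤]-injective; ≤₋-trans; ≤₋-antisym-≡; ≤₋-reflexive-≡)
open import Relation.Binary.Construct.Closure.ReflexiveTransitive using (Star; ε; _◅_; _◅◅_; reverse)
open import Relation.Binary.PropositionalEquality
  using (_≡_; _≢_; refl; sym; trans; cong; cong₂; cong-app; subst; subst₂; module ≡-Reasoning)
  renaming (setoid to ≡-setoid)
open import Relation.Nullary using (¬_; Dec; yes; no; does; _×-dec_; _⊎-dec_)
open import Relation.Nullary.Construct.Add.Infimum using (_₋; ⊥₋; [_])

-- Lists without repetition and paths in trees

-- Children are read off root paths chosen by `connected`, so nothing can be said about depth until
-- any two paths with the same ends are known to pass through the same vertices. Depth then grows by
-- one at each child, and this is what makes recursion along child lists terminate. The input lists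
-- the children in any order, whereas the recurrences speak of `children`. Recursive constructions
-- are therefore parametrised by `kids`, a permutation of the children, and sums and maxima are
-- transported along that permutation. The reference table `D` is not defined by (C), a maximum over
-- exponentially many assignments, but by the four running maxima of the program; `bestOf-maximum`
-- reconciles the two. That the output is the ESI-number is derived from `IsDPTable` alone, without
-- the machine. An optimal labelling is glued from labellings of the child subtrees. The gluing is
-- sound because subtrees of siblings are disjoint and the condition at the top of a subtree is
-- stated relative to a type promised for its parent.

module _ {A : Set} where

  unique-++⁻ : (xs : List A) {ys : List A} → Unique (xs ++ ys) →
               Unique xs × Unique ys × (∀ {x} → x ∈ xs → ¬ x ∈ ys)
  unique-++⁻ []       u       = [] , u , λ ()
  unique-++⁻ (x ∷ xs) (a ∷ u) with unique-++⁻ xs u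
  ... | uˡ , uʳ , dis =
    ++⁻ˡ xs a ∷ uˡ , uʳ ,
    λ { (here refl) y∈ys → lookupAll (++⁻ʳ xs a) y∈ys refl ; (there y∈xs) → dis y∈xs }

  unique-∷ʳ : {xs : List A} {x : A} → Unique xs → ¬ x ∈ xs → Unique (xs ∷ʳ x)
  unique-∷ʳ u x∉ = unique-++⁺ u ([] ∷ []) λ { (v∈ , here refl) → x∉ v∈ }

  unique-lookup-injective : {xs : List A} → Unique xs → ∀ {i j} → lookup xs i ≡ lookup xs j → i ≡ j
  unique-lookup-injective (_ ∷ _) {Fin.zero}  {Fin.zero}  _  = refl
  unique-lookup-injective (a ∷ _) {Fin.zero}  {Fin.suc j} eq = ⊥-elim (lookupAll a (∈-lookup j) eq)
  unique-lookup-injective (a ∷ _) {Fin.suc i} {Fin.zero}  eq = ⊥-elim (lookupAll a (∈-lookup i) (sym eq))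
  unique-lookup-injective (_ ∷ u) {Fin.suc i} {Fin.suc j} eq = cong Fin.suc (unique-lookup-injective u eq)

  unique-resp-↭ : {xs ys : List A} → xs ↭ ys → Unique xs → Unique ys
  unique-resp-↭ p = PermSetoid.Unique-resp-↭ (≡-setoid A) (↭⇒↭ₛ p)

unique⇒length≤ : ∀ {n} {xs : List (Fin n)} → Unique xs → length xs ≤ n
unique⇒length≤ u = Fin.injective⇒≤ (unique-lookup-injective u)

module Paths {n : ℕ} (G : Graph n) (tree : IsTree G) where
  open Graph G
  open IsTree tree

  head∈ : ∀ {u v} (w : Walk G u v) → u ∈ vertices G w
  head∈ ε       = here refl
  head∈ (_ ◅ _) = here refl

  end∈ : ∀ {u v} (w : Walk G u v) → v ∈ vertices G w
  end∈ ε       = here refl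
  end∈ (_ ◅ w) = there (end∈ w)

  dropTo : ∀ {u v x} (w : Walk G u v) → x ∈ vertices G w →
           Σ[ w′ ∈ Walk G x v ] ∃[ ys ] vertices G w ≡ ys ++ vertices G w′
  dropTo ε       (here refl) = ε , [] , refl
  dropTo (e ◅ w) (here refl) = e ◅ w , [] , refl
  dropTo (e ◅ w) (there x∈)  with dropTo w x∈
  ... | w′ , ys , eq = w′ , _ ∷ ys , cong (_ ∷_) eq

  takeTo : ∀ {u v x} (w : Walk G u v) → x ∈ vertices G w →
           Σ[ w′ ∈ Walk G u x ] ∃[ zs ] vertices G w ≡ vertices G w′ ++ zs
             × (x ≡ v ⊎ 0 < length zs)
  takeTo ε       (here refl) = ε , [] , refl , inj₁ refl
  takeTo (e ◅ w) (here refl) = ε , vertices G w , refl , inj₂ (nonempty w)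
    where
    nonempty : ∀ {u v} (w : Walk G u v) → 0 < length (vertices G w)
    nonempty ε       = s≤s z≤n
    nonempty (_ ◅ _) = s≤s z≤n
  takeTo (e ◅ w) (there x∈)  with takeTo w x∈
  ... | w′ , zs , eq , end = e ◅ w′ , zs , cong (_ ∷_) eq , end

  -- Avoidance of `r` is put into the relation, so that avoiding walks concatenate and reverse by
  -- the operations on `Star`.
  AdjOff : Fin n → Fin n → Fin n → Set
  AdjOff r x y = Adj x y × r ≢ x × r ≢ y

  offWalk : ∀ {r u v} (w : Walk G u v) → All (r ≢_) (vertices G w) → Star (AdjOff r) u v
  offWalk ε       _       = ε
  offWalk (e ◅ w) (a ∷ b) = (e , a , lookupAll b (head∈ w)) ◅ offWalk w b

  -- Loop erasure: if `u` recurs on the path obtained from the rest, everything before that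
  -- recurrence is dropped. The hypothesis `r ≢ u` covers the empty walk, which has no edge to
  -- exclude `r`.
  erase : ∀ {r u v} → r ≢ u → Star (AdjOff r) u v →
          Σ[ p ∈ Path G u v ] All (r ≢_) (vertices G (proj₁ p))
  erase r≢u ε = (ε , [] ∷ []) , r≢u ∷ []
  erase {u = u} r≢u ((e , _ , r≢x) ◅ w) with erase r≢x w
  ... | (p , uniq) , off with mem? Fin._≟_ u (vertices G p)
  ... | no  u∉ = (e ◅ p , tabulateAll (λ y∈ → λ { refl → u∉ y∈ }) ∷ uniq) , r≢u ∷ off
  ... | yes u∈ with dropTo p u∈
  ... | q , ys , eq =
    (q , proj₁ (proj₂ (unique-++⁻ ys (subst Unique eq uniq)))) , ++⁻ʳ ys (subst (All _) eq off)

  adj⇒≢ : ∀ {u v} → Adj u v → u ≢ v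
  adj⇒≢ e refl = loopless _ e

  -- Otherwise r together with a path from a to b avoiding r would be a cycle.
  sameNext : ∀ {r a b} → Adj r a → Adj r b → Star (AdjOff r) a b → a ≡ b
  sameNext e f w with erase (adj⇒≢ e) w
  ... | (ε , _) , _ = refl
  ... | (g ◅ p , uniq) , off =
    ⊥-elim (acyclic (e ◅ g ◅ p , off ∷ uniq) (s≤s (s≤s z≤n)) (symmetric f))

  -- The tail of `p` followed by the reversed tail of `q` avoids the common start, so by `sameNext`
  -- the second vertices agree. Lists of vertices are compared because `Adj` may have several
  -- proofs.
  unique-vertices : ∀ {u v} (p q : Walk G u v) → Unique (vertices G p) → Unique (vertices G q) →
                    vertices G p ≡ vertices G q
  unique-vertices ε       ε       _       _       = refl
  unique-vertices ε       (_ ◅ q) _       (a ∷ _) = ⊥-elim (lookupAll a (end∈ q) refl)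
  unique-vertices (_ ◅ p) ε       (a ∷ _) _       = ⊥-elim (lookupAll a (end∈ p) refl)
  unique-vertices (e ◅ p) (f ◅ q) (a ∷ u) (b ∷ v)
    with sameNext e f (offWalk p a ◅◅ reverse (λ (g , x , y) → symmetric g , y , x) (offWalk q b))
  ... | refl = cong (_ ∷_) (unique-vertices p q u v)

  uniquePath : ∀ {u v} ((p , _) (q , _) : Path G u v) → vertices G p ≡ vertices G q
  uniquePath (p , u) (q , v) = unique-vertices p q u v

  snoc : ∀ {u v x} (w : Walk G u v) (e : Adj v x) → vertices G (w ◅◅ e ◅ ε) ≡ vertices G w ∷ʳ x
  snoc ε       e = refl
  snoc (f ◅ w) e = cong (_ ∷_) (snoc w e)

  unsnoc : ∀ {u v} (w : Walk G u v) →
           (u ≡ v × vertices G w ≡ v ∷ []) ⊎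
           ∃[ q ] Adj q v × (Σ[ w′ ∈ Walk G u q ] vertices G w ≡ vertices G w′ ∷ʳ v)
  unsnoc ε       = inj₁ (refl , refl)
  unsnoc (e ◅ w) with unsnoc w
  ... | inj₁ (refl , eq)       = inj₂ (_ , e , ε , cong (_ ∷_) eq)
  ... | inj₂ (q , f , w′ , eq) = inj₂ (q , f , e ◅ w′ , cong (_ ∷_) eq)

-- Depth, ancestors and parents in a rooted tree

module Rooted {n : ℕ} (T : RootedTree n) where
  open RootedTree T renaming (root to r)
  open Paths graph isTree

  depth : Fin n → ℕ
  depth v = length (rootPath v)

  depth≤n : ∀ v → depth v ≤ n
  depth≤n v = unique⇒length≤ (proj₂ (connected r v))

  self∈rootPath : ∀ v → v ∈ rootPath v
  self∈rootPath v = end∈ (proj₁ (connected r v))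

  -- The root paths of different vertices are chosen independently. Uniqueness relates them: the
  -- path to `v` extended by the edge to `u` is again a path.
  rootPath-child : ∀ {u v} → IsChildOf u v → rootPath u ≡ rootPath v ∷ʳ u
  rootPath-child {u} {v} (e , u∉) = trans
    (uniquePath (connected r u)
      (proj₁ (connected r v) ◅◅ e ◅ ε ,
       subst Unique (sym (snoc (proj₁ (connected r v)) e)) (unique-∷ʳ (proj₂ (connected r v)) u∉)))
    (snoc (proj₁ (connected r v)) e)

  depth-child : ∀ {u v} → IsChildOf u v → depth u ≡ suc (depth v)
  depth-child {u} {v} c = trans (cong length (rootPath-child c))
    (trans (length-++ (rootPath v)) (ℕ.+-comm (depth v) 1))

  -- The initial segment ending in `u` has the vertices of the root path of `u`, and it is proper
  -- unless `u` is the last vertex.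
  ancestor-depth : ∀ {u v} → u ∈ rootPath v → u ≡ v ⊎ depth u < depth v
  ancestor-depth {u} {v} u∈ with takeTo (proj₁ (connected r v)) u∈
  ... | _ , _  , _  , inj₁ u≡v = inj₁ u≡v
  ... | w , zs , eq , inj₂ 0<  = inj₂ (subst (depth u <_)
    (sym (trans (cong length (trans eq (cong (_++ zs) w≡u))) (length-++ (rootPath u))))
    (ℕ.m<m+n (depth u) 0<))
    where
    w≡u : vertices graph w ≡ rootPath u
    w≡u = uniquePath (w , proj₁ (unique-++⁻ _ (subst Unique eq (proj₂ (connected r v))))) (connected r u)

  -- If `u` and `v` lay on each other's root paths, each would be less deep than the other.
  adj⇒child : ∀ {u v} → Adj u v → IsChildOf u v ⊎ IsChildOf v u
  adj⇒child {u} {v} e with mem? Fin._≟_ u (rootPath v)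
  ... | no  u∉ = inj₁ (symmetric e , u∉)
  ... | yes u∈ with mem? Fin._≟_ v (rootPath u)
  ... | no  v∉ = inj₂ (e , v∉)
  ... | yes v∈ with ancestor-depth u∈ | ancestor-depth v∈
  ... | inj₁ refl | _         = ⊥-elim (loopless _ e)
  ... | inj₂ _    | inj₁ refl = ⊥-elim (loopless _ e)
  ... | inj₂ u<v  | inj₂ v<u  = ⊥-elim (ℕ.<-asym u<v v<u)

  parent-unique : ∀ {u p q} → IsChildOf u p → IsChildOf u q → p ≡ q
  parent-unique {u} {p} {q} c d with ancestor-depth p∈q
    where
    p∈q : p ∈ rootPath q
    p∈q = subst (p ∈_)
      (proj₁ (∷ʳ-injective _ _ (trans (sym (rootPath-child c)) (rootPath-child d)))) (self∈rootPath p)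
  ... | inj₁ p≡q = p≡q
  ... | inj₂ p<q = ⊥-elim (ℕ.<-irrefl (ℕ.suc-injective (trans (sym (depth-child c)) (depth-child d))) p<q)

  root-orphan : ∀ {q} → ¬ IsChildOf r q
  root-orphan {q} (_ , r∉) = r∉ (head∈ (proj₁ (connected r q)))

  parent : ∀ v → v ≡ r ⊎ ∃[ q ] IsChildOf v q
  parent v with unsnoc (proj₁ (connected r v))
  ... | inj₁ (refl , _)      = inj₁ refl
  ... | inj₂ (q , e , w , eq) with unique-++⁻ (vertices graph w) (subst Unique eq (proj₂ (connected r v)))
  ... | uniq , _ , dis = inj₂ (q , e ,
    λ v∈ → dis (subst (v ∈_) (uniquePath (connected r q) (w , uniq)) v∈) (here refl))

  children-unique : ∀ v → Unique (children v)
  children-unique v = filter⁺ (λ u → isChildOf? u v) (allFin⁺ n)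

-- Recursion along child lists and the postorder it yields

module Descent {n : ℕ} (T : RootedTree n) (kids : Fin n → List (Fin n))
               (kids↭ : ∀ v → kids v ↭ RootedTree.children T v) where
  open RootedTree T renaming (root to r)
  open Rooted T

  ∈kids⁻ : ∀ {u v} → u ∈ kids v → IsChildOf u v
  ∈kids⁻ {v = v} u∈ = proj₂ (∈-filter⁻ (λ u → isChildOf? u v) {xs = allFin n} (∈-resp-↭ (kids↭ v) u∈))

  ∈kids⁺ : ∀ {u v} → IsChildOf u v → u ∈ kids v
  ∈kids⁺ {u} {v} c = ∈-resp-↭ (↭-sym (kids↭ v)) (∈-filter⁺ (λ u → isChildOf? u v) (∈-allFin u) c)

  kids-unique : ∀ v → Unique (kids v)
  kids-unique v = unique-resp-↭ (↭-sym (kids↭ v)) (children-unique v)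

  -- Rose v witnesses that the descent from v through kids terminates.
  mutual
    data Rose (v : Fin n) : Set where
      node : Forest (kids v) → Rose v

    data Forest : List (Fin n) → Set where
      []  : Forest []
      _∷_ : ∀ {u us} → Rose u → Forest us → Forest (u ∷ us)

  -- The fuel `k` satisfies `n ≤ k + depth v`. When it runs out, a child of `v` would have depth
  -- above `n`, so there is none.
  rose : ∀ v → Rose v
  rose v = grow n v (ℕ.m≤n⇒m≤n+o (depth v) ℕ.≤-refl)
    where
    mutual
      grow : ∀ k v → n ≤ k + depth v → Rose v
      grow zero    v n≤ = node (subst Forest (sym no-kids) [])
        where
        no-kids : kids v ≡ []
        no-kids with kids v in eq
        ... | []    = refl
        ... | u ∷ _ = ⊥-elim (ℕ.<-irrefl refl (ℕ.≤-trans (s≤s n≤)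
                        (subst (_≤ n) (depth-child (∈kids⁻ (subst (u ∈_) (sym eq) (here refl)))) (depth≤n u))))
      grow (suc k) v n≤ = node (grows k (kids v) (tabulateAll λ u∈ →
        subst (λ d → n ≤ k + d) (sym (depth-child (∈kids⁻ u∈)))
          (subst (n ≤_) (sym (ℕ.+-suc k (depth v))) n≤)))

      grows : ∀ k us → All (λ u → n ≤ k + depth u) us → Forest us
      grows k []       []       = []
      grows k (u ∷ us) (b ∷ bs) = grow k u b ∷ grows k us bs

  kids-induction : ∀ {ℓ} (P : Fin n → Set ℓ) → (∀ v → (∀ {u} → u ∈ kids v → P u) → P v) → ∀ v → P v
  kids-induction P step v = go (rose v)
    where
    mutual
      go : ∀ {v} → Rose v → P v
      go {v} (node f) = step v (lookupAll (gos f))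

      gos : ∀ {us} → Forest us → All P us
      gos []      = []
      gos (t ∷ f) = go t ∷ gos f

  module _ {A : Set} (alg : Fin n → List A → A) where

    mutual
      foldTree : ∀ {v} → Rose v → A
      foldTree {v} (node f) = alg v (foldForest f)

      foldForest : ∀ {us} → Forest us → List A
      foldForest []      = []
      foldForest (t ∷ f) = foldTree t ∷ foldForest f

    fold : Fin n → A
    fold v = foldTree (rose v)

    mutual
      -- The witnesses inside `rose v` need not be the `rose u` of the children. Independence of the
      -- witness is what lets `fold` satisfy its recursion equation.
      foldTree-irrelevant : ∀ {v} (t t′ : Rose v) → foldTree t ≡ foldTree t′
      foldTree-irrelevant {v} (node f) (node f′) = cong (alg v) (foldForest-irrelevant f f′)

      foldForest-irrelevant : ∀ {us} (f f′ : Forest us) → foldForest f ≡ foldForest f′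
      foldForest-irrelevant []      []        = refl
      foldForest-irrelevant (t ∷ f) (t′ ∷ f′) =
        cong₂ _∷_ (foldTree-irrelevant t t′) (foldForest-irrelevant f f′)

    foldForest-map : ∀ {us} (f : Forest us) → foldForest f ≡ map fold us
    foldForest-map []      = refl
    foldForest-map (t ∷ f) = cong₂ _∷_ (foldTree-irrelevant t (rose _)) (foldForest-map f)

    fold-unfold : ∀ v → fold v ≡ alg v (map fold (kids v))
    fold-unfold v with rose v
    ... | node f = cong (alg v) (foldForest-map f)

  post : Fin n → List (Fin n)
  post = fold λ v xss → concat xss ∷ʳ v

  post-unfold : ∀ v → post v ≡ concatMap post (kids v) ∷ʳ v
  post-unfold = fold-unfold _

  ∈posts⁻ : ∀ {w} us → w ∈ concatMap post us → ∃[ u ] u ∈ us × w ∈ post u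
  ∈posts⁻ (u ∷ us) w∈ with ∈-++⁻ (post u) w∈
  ... | inj₁ w∈u = u , here refl , w∈u
  ... | inj₂ w∈us with ∈posts⁻ us w∈us
  ... | x , x∈ , w∈x = x , there x∈ , w∈x

  ∈posts⁺ : ∀ {u w us} → u ∈ us → w ∈ post u → w ∈ concatMap post us
  ∈posts⁺ (here refl)            w∈ = ∈-++⁺ˡ w∈
  ∈posts⁺ {us = x ∷ _} (there u∈) w∈ = ∈-++⁺ʳ (post x) (∈posts⁺ u∈ w∈)

  ∈post⁻ : ∀ {v w} → w ∈ post v → w ≡ v ⊎ ∃[ u ] u ∈ kids v × w ∈ post u
  ∈post⁻ {v} w∈ with ∈-++⁻ (concatMap post (kids v)) (subst (_ ∈_) (post-unfold v) w∈)
  ... | inj₁ w∈us        = inj₂ (∈posts⁻ (kids v) w∈us)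
  ... | inj₂ (here refl) = inj₁ refl

  self∈post : ∀ v → v ∈ post v
  self∈post v = subst (v ∈_) (sym (post-unfold v)) (∈-++⁺ʳ _ (here refl))

  ∈post⁺ : ∀ {v u w} → u ∈ kids v → w ∈ post u → w ∈ post v
  ∈post⁺ {v} u∈ w∈ = subst (_ ∈_) (sym (post-unfold v)) (∈-++⁺ˡ (∈posts⁺ u∈ w∈))

  post-closed : ∀ v {w u} → w ∈ post v → u ∈ kids w → u ∈ post v
  post-closed = kids-induction (λ v → ∀ {w u} → w ∈ post v → u ∈ kids w → u ∈ post v) step
    where
    step : ∀ v → (∀ {x} → x ∈ kids v → ∀ {w u} → w ∈ post x → u ∈ kids w → u ∈ post x) →
           ∀ {w u} → w ∈ post v → u ∈ kids w → u ∈ post v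
    step v ih w∈ u∈ with ∈post⁻ w∈
    ... | inj₁ refl           = ∈post⁺ u∈ (self∈post _)
    ... | inj₂ (x , x∈ , w∈x) = ∈post⁺ x∈ (ih x∈ w∈x u∈)

  -- Membership in a subtree is turned into a prefix of root paths because prefixes separate
  -- siblings: the vertex after `rootPath v` tells in which child's subtree one is.
  ∈post⇒below : ∀ v {w} → w ∈ post v → ∃[ zs ] rootPath w ≡ rootPath v ++ zs
  ∈post⇒below = kids-induction (λ v → ∀ {w} → w ∈ post v → ∃[ zs ] rootPath w ≡ rootPath v ++ zs) step
    where
    step : ∀ v → (∀ {x} → x ∈ kids v → ∀ {w} → w ∈ post x → ∃[ zs ] rootPath w ≡ rootPath x ++ zs) →
           ∀ {w} → w ∈ post v → ∃[ zs ] rootPath w ≡ rootPath v ++ zs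
    step v ih w∈ with ∈post⁻ w∈
    ... | inj₁ refl           = [] , sym (++-identityʳ _)
    ... | inj₂ (x , x∈ , w∈x) with ih x∈ w∈x
    ... | zs , eq = x ∷ zs , trans eq
      (trans (cong (_++ zs) (rootPath-child (∈kids⁻ x∈))) (++-assoc (rootPath v) _ zs))

  ∈post-kid⇒below : ∀ {v u w} → u ∈ kids v → w ∈ post u → ∃[ zs ] rootPath w ≡ rootPath v ++ u ∷ zs
  ∈post-kid⇒below {v} {u} u∈ w∈ with ∈post⇒below u w∈
  ... | zs , eq = zs , trans eq
      (trans (cong (_++ zs) (rootPath-child (∈kids⁻ u∈))) (++-assoc (rootPath v) _ zs))

  siblings-disjoint : ∀ {v u x w} → u ∈ kids v → x ∈ kids v → w ∈ post u → w ∈ post x → u ≡ x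
  siblings-disjoint {v} u∈ x∈ w∈u w∈x with ∈post-kid⇒below u∈ w∈u | ∈post-kid⇒below x∈ w∈x
  ... | _ , eq | _ , eq′ =
    ∷-injectiveˡ (++-cancelˡ (rootPath v) _ _ (trans (sym eq) eq′))

  ∉posts-kids : ∀ v → ¬ v ∈ concatMap post (kids v)
  ∉posts-kids v v∈ with ∈posts⁻ (kids v) v∈
  ... | u , u∈ , v∈u with ∈post-kid⇒below u∈ v∈u
  ... | zs , eq with ++-cancelˡ (rootPath v) [] (u ∷ zs) (trans (++-identityʳ _) eq)
  ... | ()

  posts-unique : ∀ {v} us → Unique us → (∀ {u} → u ∈ us → u ∈ kids v) →
                 (∀ {u} → u ∈ us → Unique (post u)) → Unique (concatMap post us)
  posts-unique []       _       _  _  = []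
  posts-unique (u ∷ us) (a ∷ b) k∈ pu =
    unique-++⁺ (pu (here refl)) (posts-unique us b (k∈ ∘ there) (pu ∘ there)) disjoint
    where
    disjoint : ∀ {w} → ¬ (w ∈ post u × w ∈ concatMap post us)
    disjoint (w∈u , w∈us) with ∈posts⁻ us w∈us
    ... | x , x∈ , w∈x = lookupAll a x∈ (siblings-disjoint (k∈ (here refl)) (k∈ (there x∈)) w∈u w∈x)

  post-unique : ∀ v → Unique (post v)
  post-unique = kids-induction (Unique ∘ post) λ v ih →
    subst Unique (sym (post-unfold v))
      (unique-∷ʳ (posts-unique (kids v) (kids-unique v) (λ u∈ → u∈) ih) (∉posts-kids v))

  -- Climbing to parents lowers the depth until the root is reached, and `post r` is closed under
  -- going back down.
  ∈post-root : ∀ v → v ∈ post r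
  ∈post-root v = go (depth v) v ℕ.≤-refl
    where
    go : ∀ k v → depth v ≤ k → v ∈ post r
    go k v d≤ with parent v
    go k v d≤ | inj₁ refl = self∈post r
    go k v d≤ | inj₂ (q , c) with subst (_≤ k) (depth-child c) d≤
    go (suc k) v d≤ | inj₂ (q , c) | s≤s d≤′ = post-closed r (go k q d≤′) (∈kids⁺ c)

  post-root↭ : post r ↭ allFin n
  post-root↭ = ∼bag⇒↭ (unique∧set⇒bag (post-unique r) (allFin⁺ n)
    (mk⇔ (λ _ → ∈-allFin _) (λ _ → ∈post-root _)))

  length-post-root : length (post r) ≡ n
  length-post-root = trans (↭-length post-root↭) (length-tabulate {n = n} (λ i → i))

  postorder : ∀ v → Postorder T v (post v)
  postorder = kids-induction (λ v → Postorder T v (post v)) λ v ih →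
    subst (Postorder T v) (sym (post-unfold v)) (visit (kids↭ v) (postorders (kids v) ih))
    where
    postorders : ∀ us → (∀ {u} → u ∈ us → Postorder T u (post u)) → Postorders T us (concatMap post us)
    postorders []       _  = []
    postorders (u ∷ us) po = po (here refl) ∷ postorders us (po ∘ there)

  kidCount : List (Fin n) → ℕ
  kidCount vs = sum (map (length ∘ kids) vs)

  kidCount-++ : ∀ xs ys → kidCount (xs ++ ys) ≡ kidCount xs + kidCount ys
  kidCount-++ xs ys = trans (cong sum (map-++ (length ∘ kids) xs ys)) (sum-++ (map (length ∘ kids) xs) _)

  -- A subtree has one edge fewer than vertices. This keeps the total length of all child scans
  -- linear.
  kidCount-post : ∀ v → suc (kidCount (post v)) ≡ length (post v)
  kidCount-post = kids-induction (λ v → suc (kidCount (post v)) ≡ length (post v)) λ v ih →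
    begin
      suc (kidCount (post v))
        ≡⟨ cong (suc ∘ kidCount) (post-unfold v) ⟩
      suc (kidCount (concatMap post (kids v) ∷ʳ v))
        ≡⟨ cong suc (kidCount-++ (concatMap post (kids v)) (v ∷ [])) ⟩
      suc (kidCount (concatMap post (kids v)) + (length (kids v) + 0))
        ≡⟨ cong (λ k → suc (kidCount (concatMap post (kids v)) + k)) (ℕ.+-identityʳ _) ⟩
      suc (kidCount (concatMap post (kids v)) + length (kids v))
        ≡⟨ cong suc (posts (kids v) ih) ⟩
      suc (length (concatMap post (kids v)))
        ≡⟨ ℕ.+-comm 1 _ ⟩
      length (concatMap post (kids v)) + 1
        ≡⟨ length-++ (concatMap post (kids v)) ⟨
      length (concatMap post (kids v) ∷ʳ v)
        ≡⟨ cong length (post-unfold v) ⟨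
      length (post v)
    ∎
    where
    open ≡-Reasoning
    posts : ∀ us → (∀ {u} → u ∈ us → suc (kidCount (post u)) ≡ length (post u)) →
            kidCount (concatMap post us) + length us ≡ length (concatMap post us)
    posts []       _  = refl
    posts (u ∷ us) ih = begin
      kidCount (post u ++ concatMap post us) + suc (length us)
        ≡⟨ ℕ.+-suc _ (length us) ⟩
      suc (kidCount (post u ++ concatMap post us) + length us)
        ≡⟨ cong (λ k → suc (k + length us)) (kidCount-++ (post u) _) ⟩
      suc (kidCount (post u) + kidCount (concatMap post us) + length us)
        ≡⟨ cong suc (ℕ.+-assoc (kidCount (post u)) _ _) ⟩
      suc (kidCount (post u)) + (kidCount (concatMap post us) + length us)
        ≡⟨ cong₂ _+_ (ih (here refl)) (posts us (ih ∘ there)) ⟩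
      length (post u) + length (concatMap post us)
        ≡⟨ length-++ (post u) ⟨
      length (post u ++ concatMap post us)
      ∎

  -- The dependency order needed for filling the table. A growing predicate replaces the prefix
  -- already processed, so that the invariant of the table pass can carry it along.
  KidsFirst : (Fin n → Set) → List (Fin n) → Set
  KidsFirst Done []       = ⊤
  KidsFirst Done (v ∷ vs) = (∀ {u} → u ∈ kids v → Done u) × KidsFirst (λ w → Done w ⊎ w ≡ v) vs

  -- In continuation form: what follows `post v` may assume only that `Done` has grown and now
  -- contains `v`. Quantifying over `Done′` avoids describing the exact set reached.
  post-kidsFirst : ∀ v {Done ws} →
    (∀ {Done′} → (∀ {w} → Done w → Done′ w) → Done′ v → KidsFirst Done′ ws) →
    KidsFirst Done (post v ++ ws)
  post-kidsFirst = kids-induction P λ v ih {Done} {ws} k →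
    subst (KidsFirst Done) (sym (trans (cong (_++ ws) (post-unfold v)) (++-assoc _ (v ∷ []) ws)))
      (posts (kids v) ih λ ⊆ done → done , k (inj₁ ∘ ⊆) (inj₂ refl))
    where
    P : Fin n → Set₁
    P v = ∀ {Done ws} →
      (∀ {Done′} → (∀ {w} → Done w → Done′ w) → Done′ v → KidsFirst Done′ ws) →
      KidsFirst Done (post v ++ ws)

    posts : ∀ us {Done ws} → (∀ {u} → u ∈ us → P u) →
      (∀ {Done′} → (∀ {w} → Done w → Done′ w) → (∀ {u} → u ∈ us → Done′ u) → KidsFirst Done′ ws) →
      KidsFirst Done (concatMap post us ++ ws)
    posts []       _  k = k (λ d → d) λ ()
    posts (u ∷ us) {Done} {ws} ih k = subst (KidsFirst Done) (sym (++-assoc (post u) _ ws))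
      (ih (here refl) λ ⊆ du → posts us (ih ∘ there) λ ⊆′ dus →
        k (⊆′ ∘ ⊆) λ { (here refl) → ⊆′ du ; (there u∈) → dus u∈ })

  root-kidsFirst : KidsFirst (λ _ → ⊥) (post r)
  root-kidsFirst = subst (KidsFirst _) (++-identityʳ (post r)) (post-kidsFirst r λ _ _ → tt)

-- Maxima over assignments

encode : ℕ ₋ → ℕ
encode ⊥₋    = 0
encode [ a ] = suc a

decode-encode : ∀ A → decode (encode A) ≡ A
decode-encode ⊥₋    = refl
decode-encode [ a ] = refl

encode≤ : ∀ {A k} → A ≤₋ [ k ] → encode A ≤ suc k
encode≤ (⊥₋≤ _) = z≤n
encode≤ [ a≤k ] = s≤s a≤k

⊑-refl : ∀ {A} → A ≤₋ A
⊑-refl = ≤₋-reflexive-≡ ℕ.≤-reflexive refl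

⊑-reflexive : ∀ {A B} → A ≡ B → A ≤₋ B
⊑-reflexive = ≤₋-reflexive-≡ ℕ.≤-reflexive

⊑-trans : ∀ {A B C} → A ≤₋ B → B ≤₋ C → A ≤₋ C
⊑-trans = ≤₋-trans ℕ.≤-trans

⊑-antisym : ∀ {A B} → A ≤₋ B → B ≤₋ A → A ≡ B
⊑-antisym = ≤₋-antisym-≡ ℕ.≤-antisym

⊹-identityˡ : ∀ A → [ 0 ] ⊹ A ≡ A
⊹-identityˡ ⊥₋    = refl
⊹-identityˡ [ a ] = refl

⊹-identityʳ : ∀ A → A ⊹ [ 0 ] ≡ A
⊹-identityʳ ⊥₋    = refl
⊹-identityʳ [ a ] = cong [_] (ℕ.+-identityʳ a)

⊹-assoc : ∀ A B C → (A ⊹ B) ⊹ C ≡ A ⊹ (B ⊹ C)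
⊹-assoc ⊥₋    B     C     = refl
⊹-assoc [ a ] ⊥₋    C     = refl
⊹-assoc [ a ] [ b ] ⊥₋    = refl
⊹-assoc [ a ] [ b ] [ c ] = cong [_] (ℕ.+-assoc a b c)

⊹-comm : ∀ A B → A ⊹ B ≡ B ⊹ A
⊹-comm ⊥₋    ⊥₋    = refl
⊹-comm ⊥₋    [ b ] = refl
⊹-comm [ a ] ⊥₋    = refl
⊹-comm [ a ] [ b ] = cong [_] (ℕ.+-comm a b)

⊹-mono : ∀ {A B C D} → A ≤₋ C → B ≤₋ D → A ⊹ B ≤₋ C ⊹ D
⊹-mono (⊥₋≤ _) _        = ⊥₋≤ _
⊹-mono [ _ ]   (⊥₋≤ _)  = ⊥₋≤ _
⊹-mono [ a≤c ] [ b≤d ]  = [ ℕ.+-mono-≤ a≤c b≤d ]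

max-⊑ˡ : ∀ A B → A ≤₋ max A B
max-⊑ˡ ⊥₋    B     = ⊥₋≤ _
max-⊑ˡ [ a ] ⊥₋    = ⊑-refl
max-⊑ˡ [ a ] [ b ] = [ ℕ.m≤m⊔n a b ]

max-⊑ʳ : ∀ A B → B ≤₋ max A B
max-⊑ʳ ⊥₋    B     = ⊑-refl
max-⊑ʳ [ a ] ⊥₋    = ⊥₋≤ _
max-⊑ʳ [ a ] [ b ] = [ ℕ.m≤n⊔m a b ]

max-sel : ∀ A B → max A B ≡ A ⊎ max A B ≡ B
max-sel ⊥₋    B     = inj₂ refl
max-sel [ a ] ⊥₋    = inj₁ refl
max-sel [ a ] [ b ] with ℕ.⊔-sel a b
... | inj₁ eq = inj₁ (cong [_] eq)
... | inj₂ eq = inj₂ (cong [_] eq)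

max-lub : ∀ {A B C} → A ≤₋ C → B ≤₋ C → max A B ≤₋ C
max-lub {A} {B} p q with max-sel A B
... | inj₁ eq = subst (_≤₋ _) (sym eq) p
... | inj₂ eq = subst (_≤₋ _) (sym eq) q

maximum-⊑ : ∀ {A As} → A ∈ As → A ≤₋ maximum As
maximum-⊑ (here refl)        = max-⊑ˡ _ _
maximum-⊑ {As = B ∷ _} (there A∈) = ⊑-trans (maximum-⊑ A∈) (max-⊑ʳ B _)

maximum-attained : ∀ {a} As → maximum As ≡ [ a ] → [ a ] ∈ As
maximum-attained (A ∷ As) eq with max-sel A (maximum As)
... | inj₁ p = here (trans (sym eq) p)
... | inj₂ p = there (maximum-attained As (trans (sym p) eq))

module _ {V : Set} where

  sumOf-cong : ∀ {f g : V → ℕ ₋} us → (∀ {u} → u ∈ us → f u ≡ g u) → sumOf f us ≡ sumOf g us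
  sumOf-cong []       _  = refl
  sumOf-cong (u ∷ us) eq = cong₂ _⊹_ (eq (here refl)) (sumOf-cong us (eq ∘ there))

  sumOf-mono : ∀ {f g : V → ℕ ₋} us → (∀ {u} → u ∈ us → f u ≤₋ g u) → sumOf f us ≤₋ sumOf g us
  sumOf-mono []       _ = ⊑-refl
  sumOf-mono (u ∷ us) p = ⊹-mono (p (here refl)) (sumOf-mono us (p ∘ there))

  sumOf-↭ : ∀ (f : V → ℕ ₋) {us vs} → us ↭ vs → sumOf f us ≡ sumOf f vs
  sumOf-↭ f ↭-refl         = refl
  sumOf-↭ f (prep u p)     = cong (f u ⊹_) (sumOf-↭ f p)
  sumOf-↭ f (swap {us} {vs} u v p) =
    trans (cong (λ A → f u ⊹ (f v ⊹ A)) (sumOf-↭ f p))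
      (trans (sym (⊹-assoc (f u) (f v) _))
        (trans (cong (_⊹ sumOf f vs) (⊹-comm (f u) (f v))) (⊹-assoc (f v) (f u) _)))
  sumOf-↭ f (↭-trans p q)  = trans (sumOf-↭ f p) (sumOf-↭ f q)

  sumOf-map : ∀ {W : Set} (f : W → ℕ ₋) (g : V → W) us → sumOf f (map g us) ≡ sumOf (f ∘ g) us
  sumOf-map f g []       = refl
  sumOf-map f g (u ∷ us) = cong (f (g u) ⊹_) (sumOf-map f g us)

  ∈-assignments⁺ : ∀ (a : Assignment V) → a ∈ assignments (map proj₁ a)
  ∈-assignments⁺ []            = here refl
  ∈-assignments⁺ ((u , x) ∷ a) =
    ∈-concatMap⁺ (λ y → map ((u , y) ∷_) (assignments (map proj₁ a))) {xs = S ∷ N ∷ R ∷ []} (at x)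
    where
    a∈ : ∀ y → ((u , y) ∷ a) ∈ map ((u , y) ∷_) (assignments (map proj₁ a))
    a∈ y = ∈-map⁺ ((u , y) ∷_) (∈-assignments⁺ a)

    at : ∀ x → Any (λ y → ((u , x) ∷ a) ∈ map ((u , y) ∷_) (assignments (map proj₁ a))) (S ∷ N ∷ R ∷ [])
    at S = here (a∈ S)
    at N = there (here (a∈ N))
    at R = there (there (here (a∈ R)))

  ∈-assignments⁻ : ∀ us {a : Assignment V} → a ∈ assignments us → map proj₁ a ≡ us
  ∈-assignments⁻ []       (here refl) = refl
  ∈-assignments⁻ (u ∷ us) a∈ with satisfied (∈-concatMap⁻ (λ y → map ((u , y) ∷_) (assignments us)) {xs = S ∷ N ∷ R ∷ []} a∈)
  ... | y , a∈y with ∈-map⁻ ((u , y) ∷_) a∈y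
  ... | a′ , a′∈ , refl = cong (u ∷_) (∈-assignments⁻ us a′∈)

-- Running maxima over the children scanned so far

ChildTable : Set
ChildTable = Type → Type → ℕ ₋

Best : Set
Best = Bool → Bool → ℕ ₋

extendBest : Best → ChildTable → Best
extendBest b c s r = max (b false r ⊹ c S N) (max (b s r ⊹ c N N) (b s false ⊹ c R N))

emptyBest : Best
emptyBest false false = [ 0 ]
emptyBest false true  = ⊥₋
emptyBest true  _     = ⊥₋

bestOf : Best → List ChildTable → Best
bestOf = foldl extendBest

needS needR : Type → Bool
needS S = false
needS N = true
needS R = true
needR S = true
needR N = true
needR R = false

-- What is still demanded of the earlier children once the newest one has the given type.
afterS afterR : Type → Bool → Bool
afterS S _ = false
afterS N s = s
afterS R s = s
afterR S r = r
afterR N r = r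
afterR R _ = false

-- The recurrences in the form the machine evaluates them, with the maximum in (C) replaced by a
-- left-to-right scan that keeps four values.
entry : Type → Type → List ChildTable → ℕ ₋
entry S S cs = ⊥₋
entry S N cs = [ 1 ] ⊹ sumOf (λ c → c N S) cs
entry S R cs = ⊥₋
entry N p cs = bestOf emptyBest cs (needS p) (needR p)
entry R S cs = ⊥₋
entry R N cs = sumOf (λ c → max (c N R) (c R R)) cs
entry R R cs = sumOf (λ c → max (c N R) (c R R)) cs

extendBest-⊑ : ∀ b c s r x → b (afterS x s) (afterR x r) ⊹ c x N ≤₋ extendBest b c s r
extendBest-⊑ b c s r S = max-⊑ˡ _ _
extendBest-⊑ b c s r N = ⊑-trans (max-⊑ˡ _ (b s false ⊹ c R N)) (max-⊑ʳ (b false r ⊹ c S N) _)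
extendBest-⊑ b c s r R = ⊑-trans (max-⊑ʳ (b s r ⊹ c N N) _) (max-⊑ʳ (b false r ⊹ c S N) _)

extendBest-attained : ∀ b c s r → ∃[ x ] extendBest b c s r ≡ b (afterS x s) (afterR x r) ⊹ c x N
extendBest-attained b c s r with max-sel (b false r ⊹ c S N) (max (b s r ⊹ c N N) (b s false ⊹ c R N))
... | inj₁ eq = S , eq
... | inj₂ eq with max-sel (b s r ⊹ c N N) (b s false ⊹ c R N)
... | inj₁ eq′ = N , trans eq eq′
... | inj₂ eq′ = R , trans eq eq′

extendBest-≤ : ∀ {b c k l} → (∀ s r → b s r ≤₋ [ k ]) → (∀ x → c x N ≤₋ [ l ]) →
         ∀ s r → extendBest b c s r ≤₋ [ k + l ]
extendBest-≤ b≤ c≤ s r = max-lub (⊹-mono (b≤ false r) (c≤ S))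
  (max-lub (⊹-mono (b≤ s r) (c≤ N)) (⊹-mono (b≤ s false) (c≤ R)))

emptyBest≤ : ∀ s r → emptyBest s r ≤₋ [ 0 ]
emptyBest≤ false false = ⊑-refl
emptyBest≤ false true  = ⊥₋≤ _
emptyBest≤ true  _     = ⊥₋≤ _

module _ {V : Set} where

  -- Whether S (or R) is still to be used by the other children once those in
  -- the assignment have got their types.
  restS restR : Assignment V → Bool → Bool
  restS []            s = s
  restS ((_ , x) ∷ a) s = afterS x (restS a s)
  restR []            r = r
  restR ((_ , x) ∷ a) r = afterR x (restR a r)

  restS-false : ∀ a → restS a false ≡ false
  restS-false []            = refl
  restS-false ((_ , S) ∷ a) = refl
  restS-false ((_ , N) ∷ a) = restS-false a
  restS-false ((_ , R) ∷ a) = restS-false a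

  restR-false : ∀ a → restR a false ≡ false
  restR-false []            = refl
  restR-false ((_ , S) ∷ a) = restR-false a
  restR-false ((_ , N) ∷ a) = restR-false a
  restR-false ((_ , R) ∷ a) = refl

  usesS⇒restS : ∀ {a} s → Uses S a → restS a s ≡ false
  usesS⇒restS s (here refl)                   = refl
  usesS⇒restS {(_ , S) ∷ a} s (there u) = refl
  usesS⇒restS {(_ , N) ∷ a} s (there u) = usesS⇒restS s u
  usesS⇒restS {(_ , R) ∷ a} s (there u) = usesS⇒restS s u

  usesR⇒restR : ∀ {a} r → Uses R a → restR a r ≡ false
  usesR⇒restR r (here refl)                   = refl
  usesR⇒restR {(_ , S) ∷ a} r (there u) = usesR⇒restR r u
  usesR⇒restR {(_ , N) ∷ a} r (there u) = usesR⇒restR r u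
  usesR⇒restR {(_ , R) ∷ a} r (there u) = refl

  restS⇒usesS : ∀ a → restS a true ≡ false → Uses S a
  restS⇒usesS ((_ , S) ∷ a) eq = here refl
  restS⇒usesS ((_ , N) ∷ a) eq = there (restS⇒usesS a eq)
  restS⇒usesS ((_ , R) ∷ a) eq = there (restS⇒usesS a eq)

  restR⇒usesR : ∀ a → restR a true ≡ false → Uses R a
  restR⇒usesR ((_ , S) ∷ a) eq = there (restR⇒usesR a eq)
  restR⇒usesR ((_ , N) ∷ a) eq = there (restR⇒usesR a eq)
  restR⇒usesR ((_ , R) ∷ a) eq = here refl

  admissible⇒rest : ∀ p {a} → Admissible p a → restS a (needS p) ≡ false × restR a (needR p) ≡ false
  admissible⇒rest S {a} (_ , r) = restS-false a , usesR⇒restR true (r λ ())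
  admissible⇒rest N     (s , r) = usesS⇒restS true (s λ ()) , usesR⇒restR true (r λ ())
  admissible⇒rest R {a} (s , _) = usesS⇒restS true (s λ ()) , restR-false a

  rest⇒admissible : ∀ p {a} → restS a (needS p) ≡ false → restR a (needR p) ≡ false → Admissible p a
  rest⇒admissible S {a} s r = (λ S≢S → ⊥-elim (S≢S refl)) , λ _ → restR⇒usesR a r
  rest⇒admissible N {a} s r = (λ _ → restS⇒usesS a s) , λ _ → restR⇒usesR a r
  rest⇒admissible R {a} s r = (λ _ → restS⇒usesS a s) , λ R≢R → ⊥-elim (R≢R refl)

  emptyBest-attained : ∀ s r → (s ≡ false × r ≡ false) ⊎ emptyBest s r ≡ ⊥₋
  emptyBest-attained false false = inj₁ (refl , refl)
  emptyBest-attained false true  = inj₂ refl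
  emptyBest-attained true  r     = inj₂ refl

  module _ (D : V → ChildTable) where

    value : Assignment V → ℕ ₋
    value = sumOf (λ ux → D (proj₁ ux) (proj₂ ux) N)

    -- The start `b` is arbitrary because `foldl` changes it at every step; it has to meet whatever
    -- demand `a` leaves open.
    bestOf-⊑ : ∀ b a s r →
      b (restS a s) (restR a r) ⊹ value a ≤₋ bestOf b (map D (map proj₁ a)) s r
    bestOf-⊑ b []            s r = ⊑-reflexive (⊹-identityʳ _)
    bestOf-⊑ b ((u , x) ∷ a) s r = ⊑-trans
      (subst (_≤₋ extendBest b (D u) (restS a s) (restR a r) ⊹ value a) (⊹-assoc _ (D u x N) (value a))
        (⊹-mono (extendBest-⊑ b (D u) (restS a s) (restR a r) x) ⊑-refl))
      (bestOf-⊑ (extendBest b (D u)) a s r)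

    bestOf-attained : ∀ b us s r → ∃[ a ] map proj₁ a ≡ us ×
      bestOf b (map D us) s r ≡ b (restS a s) (restR a r) ⊹ value a
    bestOf-attained b []       s r = [] , refl , sym (⊹-identityʳ _)
    bestOf-attained b (u ∷ us) s r with bestOf-attained (extendBest b (D u)) us s r
    ... | a , a≡ , eq with extendBest-attained b (D u) (restS a s) (restR a r)
    ... | x , eqx = (u , x) ∷ a , cong (u ∷_) a≡ ,
      trans eq (trans (cong (_⊹ value a) eqx) (⊹-assoc _ (D u x N) (value a)))

    -- `emptyBest` is -∞ at every open demand, so exactly the assignments that meet all demands
    -- count, and these are the admissible ones. An optimal assignment for one order of the children
    -- is permuted into one for the other order.
    bestOf-maximum : ∀ p {us vs} → us ↭ vs →
      bestOf emptyBest (map D us) (needS p) (needR p) ≡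
      maximum (map value (filter (admissible? p) (assignments vs)))
    bestOf-maximum p {us} {vs} us↭vs = ⊑-antisym lower upper
      where
      Max : ℕ ₋
      Max = maximum (map value (filter (admissible? p) (assignments vs)))

      lower : bestOf emptyBest (map D us) (needS p) (needR p) ≤₋ Max
      lower with bestOf-attained emptyBest us (needS p) (needR p)
      ... | a , refl , eq with emptyBest-attained (restS a (needS p)) (restR a (needR p))
      ... | inj₂ ⊥eq = subst (_≤₋ Max) (sym (trans eq (cong (_⊹ value a) ⊥eq))) (⊥₋≤ _)
      ... | inj₁ (s , r) with ↭-map-inv proj₁ us↭vs
      ... | a′ , refl , a↭a′ = subst (_≤₋ Max)
        (sym (trans eq (trans (cong₂ (λ s r → emptyBest s r ⊹ value a) s r)
          (trans (⊹-identityˡ _) (sumOf-↭ _ a↭a′)))))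
        (maximum-⊑ (∈-map⁺ value (∈-filter⁺ (admissible? p) (∈-assignments⁺ a′) adm)))
        where
        adm : Admissible p a′
        adm with rest⇒admissible p {a} s r
        ... | usesS , usesR = Any-resp-↭ a↭a′ ∘ usesS , Any-resp-↭ a↭a′ ∘ usesR

      upper : Max ≤₋ bestOf emptyBest (map D us) (needS p) (needR p)
      upper with Max in eq
      ... | ⊥₋ = ⊥₋≤ _
      ... | [ m ] with ∈-map⁻ value (maximum-attained _ eq)
      ... | a , a∈ , m≡ with ∈-filter⁻ (admissible? p) {xs = assignments vs} a∈
      ... | a∈vs , usesS , usesR with ∈-assignments⁻ vs a∈vs
      ... | refl with ↭-map-inv proj₁ (↭-sym us↭vs)
      ... | a′ , refl , a↭a′ with admissible⇒rest p {a′} (Any-resp-↭ a↭a′ ∘ usesS , Any-resp-↭ a↭a′ ∘ usesR)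
      ... | s , r = subst (_≤₋ bestOf emptyBest (map D (map proj₁ a′)) (needS p) (needR p))
        (trans (cong₂ (λ s r → emptyBest s r ⊹ value a′) s r)
          (trans (⊹-identityˡ _) (trans (sumOf-↭ _ (↭-sym a↭a′)) (sym m≡))))
        (bestOf-⊑ emptyBest a′ (needS p) (needR p))

-- Total correctness on the machine

-- A Boolean computed from the syntax, so that for concrete programs the side condition of `frame`
-- is `refl`.
modifies : Stmt → Array → Bool
modifies (a ⟨ _ ⟩≔ _) b = does (a Fin.≟ b)
modifies (s ⨾ s′)     b = modifies s b ∨ modifies s′ b
modifies (while _ s)  b = modifies s b

frame : ∀ {M s σ σ′ t} → Exec M s σ σ′ t → ∀ b → modifies s b ≡ false → σ′ b ≡ σ b
frame (assign {a = a} {σ = σ} _ _) b eq with a Fin.≟ b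
... | no a≢b = updateAt-minimal b a σ (λ b≡a → a≢b (sym b≡a))
frame (seq {s₁ = s₁} x y) b eq with modifies s₁ b in eq₁
... | false = trans (frame y b eq) (frame x b eq₁)
frame (stop _ _) b eq = refl
frame (loop _ _ x y) b eq = trans (frame y b eq) (frame x b eq)

-- Each loop is charged for one test and one body. The factor `suc m` in `Run` pays for the
-- iterations and for the final failing test.
weight : Stmt → ℕ
weight (_ ⟨ e ⟩≔ f) = 1 + cost e + cost f
weight (s ⨾ s′)     = weight s + weight s′
weight (while e s)  = 1 + cost e + weight s

-- Here m is the number of iterations granted to all loops of s together.
record Run (M m : ℕ) (s : Stmt) (σ : State) (Q : State → Set) : Set where
  constructor run
  field
    {final} : State
    {time}  : ℕ
    exec    : Exec M s σ final time
    time≤   : time ≤ weight s * suc m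
    holds   : Q final

module _ {M m : ℕ} where

  run-≔ : ∀ {a e f σ} {Q : State → Set} (i x : ℕ) →
          Fits M σ e → ⟦ e ⟧ σ ≡ i → Fits M σ f → ⟦ f ⟧ σ ≡ x →
          Q (write a i x σ) → Run M m (a ⟨ e ⟩≔ f) σ Q
  run-≔ {e = e} {f} i x fe refl ff refl q = run (assign fe ff) (ℕ.m≤m*n _ (suc m)) q

  infixr 3 _⨾ᵣ_

  -- Since weights add, each part may use the whole of `m`: the iterations of consecutive loops need
  -- not be summed.
  _⨾ᵣ_ : ∀ {s s′ σ} {Q P : State → Set} → Run M m s σ Q →
         (∀ {σ′} → Q σ′ → Run M m s′ σ′ P) → Run M m (s ⨾ s′) σ P
  _⨾ᵣ_ {s} {s′} (run {time = t} x t≤ q) k with k q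
  ... | run {time = t′} x′ t≤′ p = run (seq x x′)
    (subst (t + t′ ≤_) (sym (ℕ.*-distribʳ-+ (suc m) (weight s) (weight s′))) (ℕ.+-mono-≤ t≤ t≤′)) p

  infixr 3 _⟶_

  -- The new state stays an explicit `write`, so that reads of concrete cells in the rest of the
  -- program reduce.
  _⟶_ : ∀ {a e f i x s σ} {Q : State → Set} →
        (Fits M σ e × ⟦ e ⟧ σ ≡ i) × (Fits M σ f × ⟦ f ⟧ σ ≡ x) →
        Run M m s (write a i x σ) Q → Run M m (a ⟨ e ⟩≔ f ⨾ s) σ Q
  _⟶_ {a = a} {i = i} {x} {σ = σ} ((fe , p) , (ff , q)) r =
    run-≔ {Q = _≡ write a i x σ} i x fe p ff q refl ⨾ᵣ λ { refl → r }

  run-map : ∀ {s σ} {Q P : State → Set} → (∀ {σ′} → Q σ′ → P σ′) → Run M m s σ Q → Run M m s σ P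
  run-map k (run x t≤ q) = run x t≤ (k q)

  run-frame : ∀ {s σ} {Q : State → Set} → Run M m s σ Q →
              Run M m s σ (λ σ′ → Q σ′ × (∀ b → modifies s b ≡ false → σ′ b ≡ σ b))
  run-frame (run x t≤ q) = run x t≤ (q , frame x)

run-more : ∀ {M m m′ s σ} {Q : State → Set} → m ≤ m′ → Run M m s σ Q → Run M m′ s σ Q
run-more {s = s} m≤ (run x t≤ q) =
  run x (ℕ.≤-trans t≤ (ℕ.*-monoʳ-≤ (weight s) (s≤s m≤))) q

module _ {M : ℕ} {e : Expr} {s : Stmt} where

  run-stop : ∀ {m σ} {Q : State → Set} → Fits M σ e → ⟦ e ⟧ σ ≡ 0 → Q σ → Run M m (while e s) σ Q
  run-stop {m} f eq q =
    run (stop f eq) (ℕ.≤-trans (ℕ.m≤m+n _ (weight s)) (ℕ.m≤m*n _ (suc m))) q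

  -- The extra unit separates two shares of the weight: `suc m` for this test and body, `suc m′` for
  -- all later iterations.
  run-loop : ∀ {m m′ σ} {P Q : State → Set} → Fits M σ e → ⟦ e ⟧ σ ≢ 0 →
             Run M m s σ P → (∀ {σ′} → P σ′ → Run M m′ (while e s) σ′ Q) →
             Run M (suc m + m′) (while e s) σ Q
  run-loop {m} {m′} f ≢0 (run {time = t} x t≤ p) k with k p
  ... | run {time = t′} x′ t≤′ q = run (loop f ≢0 x x′) bound q
    where
    open ℕ.≤-Reasoning
    c = 1 + cost e

    bound : c + t + t′ ≤ (c + weight s) * suc (suc m + m′)
    bound = begin
      c + t + t′
        ≤⟨ ℕ.+-mono-≤ (ℕ.+-mono-≤ (ℕ.m≤m*n c (suc m)) t≤) t≤′ ⟩
      c * suc m + weight s * suc m + (c + weight s) * suc m′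
        ≡⟨ cong (_+ (c + weight s) * suc m′) (sym (ℕ.*-distribʳ-+ (suc m) c (weight s))) ⟩
      (c + weight s) * suc m + (c + weight s) * suc m′
        ≡⟨ sym (ℕ.*-distribˡ-+ (c + weight s) (suc m) (suc m′)) ⟩
      (c + weight s) * (suc m + suc m′)
        ≡⟨ cong ((c + weight s) *_) (ℕ.+-suc (suc m) m′) ⟩
      (c + weight s) * suc (suc m + m′) ∎

linked⇒≤ : ∀ {n nxt x} {us : List (Fin n)} → Linked nxt x us → x ≤ n
linked⇒≤ []      = z≤n
linked⇒≤ (u ∷ _) = Fin.toℕ<n u

-- Used to keep rows that are already correct: a write to another row is harmless, and a write to
-- the same row stores the value it should hold anyway. No case distinction on the rows is then left
-- to the caller.
overwrite : ∀ {n} {v w : Fin n} {x y z : ℕ} → (w ≡ v → x ≡ y) → z ≡ y →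
            (if toℕ w ≡ᵇ toℕ v then x else z) ≡ y
overwrite {v = v} {w} x≡y z≡y with toℕ w ≡ᵇ toℕ v in eq
... | true  = x≡y (Fin.toℕ-injective (ℕ.≡ᵇ⇒≡ (toℕ w) (toℕ v) (subst T (sym eq) _)))
... | false = z≡y

overwrite-here : ∀ i {x z : ℕ} → (if i ≡ᵇ i then x else z) ≡ x
overwrite-here i with i ≡ᵇ i | ℕ.≡⇒≡ᵇ i i refl
... | true | _ = refl

overwrite-there : ∀ {i j} {x z : ℕ} → i ≢ j → (if i ≡ᵇ j then x else z) ≡ z
overwrite-there {i} {j} i≢j with i ≡ᵇ j in eq
... | false = refl
... | true  with () ← i≢j (ℕ.≡ᵇ⇒≡ i j (subst T (sym eq) _))

-- Word bounds and loops over child lists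

module Programs {n M : ℕ} (room : 3 + (n + n) ≤ M) (1≤n : 1 ≤ n) where

  -- The largest intermediate number is the sum inside `⊞` of two codes. Values are at most `n` and
  -- codes are shifted by one, whence `suc n + suc n` and the room of `3 + (n + n)`.
  <M : ∀ {k} → k ≤ suc n + suc n → k < M
  <M {k} k≤ = ℕ.≤-trans (s≤s (subst (k ≤_) (ℕ.+-suc (suc n) n) k≤)) room

  1+n<M : ∀ {k} → k ≤ suc n → k < M
  1+n<M k≤ = <M (ℕ.≤-trans k≤ (ℕ.m≤m+n (suc n) (suc n)))

  vertex<M : ∀ (v : Fin n) → toℕ v < M
  vertex<M v = 1+n<M (ℕ.m≤n⇒m≤1+n (ℕ.<⇒≤ (Fin.toℕ<n v)))

  0<M : 0 < M
  0<M = 1+n<M z≤n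

  1<M : 1 < M
  1<M = 1+n<M (s≤s z≤n)

  2<M : 2 < M
  2<M = 1+n<M (s≤s 1≤n)

  -- The bound `k` travels with the value because a sum is known to fit only when its summands are
  -- known to be small.
  record Eval (σ : State) (e : Expr) (A : ℕ ₋) (k : ℕ) : Set where
    constructor eval
    field
      encodes : ⟦ e ⟧ σ ≡ encode A
      fits    : Fits M σ e
      bounded : A ≤₋ [ k ]

  cell-fits : ∀ {x A k} → x ≡ encode A → A ≤₋ [ k ] → k ≤ n → x < M
  cell-fits refl A≤ k≤ = 1+n<M (ℕ.≤-trans (encode≤ A≤) (s≤s k≤))

  eval-var : ∀ {σ a A k} → σ a 0 ≡ encode A → A ≤₋ [ k ] → k ≤ n → Eval σ (var a) A k
  eval-var eq A≤ k≤ = eval eq (0<M , cell-fits eq A≤ k≤) A≤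

  eval-⊞ : ∀ {σ e f A B k l} → Eval σ e A k → Eval σ f B l → k ≤ n → l ≤ n → Eval σ (e ⊞ f) (A ⊹ B) (k + l)
  eval-⊞ {σ} {e} {f} {A} {B} (eval eq fe A≤) (eval eq′ ff B≤) k≤ l≤ =
    eval (trans (cong₂ sumWord eq eq′) (sumWord-encode A B))
         (fe , subst₂ SumFits (sym eq) (sym eq′) (sum-fits A B A≤ B≤))
         (⊹-mono A≤ B≤)
    where
    sumWord : ℕ → ℕ → ℕ
    sumWord a b = branch a (branch b (a + b ∸ 1) 0) 0

    sumWord-encode : ∀ A B → sumWord (encode A) (encode B) ≡ encode (A ⊹ B)
    sumWord-encode ⊥₋    B     = refl
    sumWord-encode [ a ] ⊥₋    = refl
    sumWord-encode [ a ] [ b ] = ℕ.+-suc a b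

    -- `Fits` of the nested conditional as a function of the two words, so that it can be moved to
    -- their encodings and computes there.
    SumFits : ℕ → ℕ → Set
    SumFits a b = branch a (Fits M σ f ×
      branch b ((Fits M σ e × Fits M σ f × a + b < M) × 1 < M) (0 < M)) (0 < M)

    sum-fits : ∀ A B → A ≤₋ [ _ ] → B ≤₋ [ _ ] → SumFits (encode A) (encode B)
    sum-fits ⊥₋    B     _      _      = 0<M
    sum-fits [ a ] ⊥₋    _      _      = ff , 0<M
    sum-fits [ a ] [ b ] [ a≤ ] [ b≤ ] =
      ff , (fe , ff , <M (ℕ.+-mono-≤ (s≤s (ℕ.≤-trans a≤ k≤)) (s≤s (ℕ.≤-trans b≤ l≤)))) , 1<M

  +∸≡⊔ : ∀ a b → a + (b ∸ a) ≡ a ⊔ b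
  +∸≡⊔ zero    b       = refl
  +∸≡⊔ (suc a) zero    = cong suc (ℕ.+-identityʳ a)
  +∸≡⊔ (suc a) (suc b) = cong suc (+∸≡⊔ a b)

  encode-max : ∀ A B → encode A ⊔ encode B ≡ encode (max A B)
  encode-max ⊥₋    B     = refl
  encode-max [ a ] ⊥₋    = refl
  encode-max [ a ] [ b ] = refl

  eval-max : ∀ {σ e f A B k} → Eval σ e A k → Eval σ f B k → k ≤ n → Eval σ (maxᵉ e f) (max A B) k
  eval-max {σ} {e} {f} {A} {B} (eval eq fe A≤) (eval eq′ ff B≤) k≤ =
    eval encoded (fe , (ff , fe) , cell-fits encoded (max-lub A≤ B≤) k≤) (max-lub A≤ B≤)
    where
    encoded : ⟦ maxᵉ e f ⟧ σ ≡ encode (max A B)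
    encoded = trans (cong₂ (λ a b → a + (b ∸ a)) eq eq′) (trans (+∸≡⊔ (encode A) _) (encode-max A B))

  eval-dp : ∀ {σ a x p A k} (v : Fin n) → σ a 0 ≡ toℕ v → σ (dp x p) (toℕ v) ≡ encode A →
            A ≤₋ [ k ] → k ≤ n → Eval σ DP[ a ][ x ][ p ] A k
  eval-dp {σ} {x = x} {p} v a≡ eq A≤ k≤ =
    eval eq′ ((0<M , subst (_< M) (sym a≡) (vertex<M v)) , cell-fits eq′ A≤ k≤) A≤
    where eq′ = trans (cong (σ (dp x p)) a≡) eq

  module _ (s : Stmt) (Inv : List (Fin n) → State → Set)
           (keeps-kid  : modifies s kid ≡ false)
           (keeps-next : modifies s next ≡ false)
           (stable-kid : ∀ {us σ x} → Inv us σ → Inv us (write kid 0 x σ))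
           (stable-ptr : ∀ {us σ x} → Inv us σ → Inv us (write ptr 0 x σ))
           (body : ∀ {u us σ} → Inv (u ∷ us) σ → σ kid 0 ≡ toℕ u → Run M 0 s σ (Inv us)) where

    -- `Inv` is indexed by the children still to come. The body has no loop iterations of its own,
    -- so one iteration per child is spent; it must leave `kid` and `next` intact for the following
    -- link to be found.
    run-scan : ∀ us {σ x} → σ ptr 0 ≡ x → Linked (σ next) x us → Inv us σ →
      Run M (length us)
        (while (var ptr) (kid ≔ var ptr ⊖ lit 1 ⨾ s ⨾ ptr ≔ next ⟨ var kid ⟩)) σ (Inv [])
    run-scan [] eq [] inv = run-stop (0<M , subst (_< M) (sym eq) 0<M) eq inv
    run-scan (u ∷ us) {σ} eq (_ ∷ l) inv =
      run-loop {m = 0} fits (λ eq′ → ℕ.0≢1+n (trans (sym eq′) eq)) iteration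
        λ { (inv′ , l′) → run-scan us refl l′ inv′ }
      where
      fits : Fits M σ (var ptr)
      fits = 0<M , subst (_< M) (sym eq) (1+n<M (ℕ.m≤n⇒m≤1+n (Fin.toℕ<n u)))

      iteration : Run M 0 (kid ≔ var ptr ⊖ lit 1 ⨾ s ⨾ ptr ≔ next ⟨ var kid ⟩) σ
                    (λ σ′ → Inv us σ′ × Linked (σ′ next) (σ′ ptr 0) us)
      iteration =
        ((0<M , refl) , ((fits , 1<M) , cong (_∸ 1) eq)) ⟶
        run-frame (body (stable-kid inv) refl) ⨾ᵣ λ {σ₂} (inv₂ , fr) →
          let kid≡  = cong (λ row → row 0) (fr kid keeps-kid)
              next≡ = fr next keeps-next
              l₂    = subst (λ row → Linked row (row (toℕ u)) us) (sym next≡) l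
              at    = cong (σ₂ next) kid≡
          in run-≔ 0 (σ₂ next (toℕ u)) 0<M refl
               ((0<M , subst (_< M) (sym kid≡) (vertex<M u)) ,
                subst (_< M) (sym at) (1+n<M (ℕ.m≤n⇒m≤1+n (linked⇒≤ l₂))))
               at (stable-ptr inv₂ , l₂)

    run-forChildren : ∀ v us {σ} → σ cur 0 ≡ toℕ v → Linked (σ next) (σ first (toℕ v)) us → Inv us σ →
      Run M (length us) (forChildren s) σ (Inv [])
    run-forChildren v us {σ} cur≡ l inv =
      ((0<M , refl) ,
       (((0<M , subst (_< M) (sym cur≡) (vertex<M v)) ,
         subst (_< M) (sym at) (1+n<M (ℕ.m≤n⇒m≤1+n (linked⇒≤ l)))) , at)) ⟶
      run-scan us refl l (stable-ptr inv)
      where at = cong (σ first) cur≡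

  -- The scans that fill the three types of a table row

  module Tables (kids : Fin n → List (Fin n)) (D : Fin n → ChildTable) (w : Fin n → ℕ)
           (D-eq : ∀ v x p → D v x p ≡ entry x p (map D (kids v)))
           (D≤w : ∀ v x p → D v x p ≤₋ [ w v ])
           (w≤n : ∀ v → w v ≤ n)
           (w-kids : ∀ v → suc (sum (map w (kids v))) ≤ n) where

    Filled : Fin n → State → Set
    Filled u σ = ∀ x p → σ (dp x p) (toℕ u) ≡ encode (D u x p)

    AllFilled : List (Fin n) → State → Set
    AllFilled us σ = ∀ {u} → u ∈ us → Filled u σ

    eval-kid : ∀ {σ u} x p → Filled u σ → σ kid 0 ≡ toℕ u → Eval σ DP[ kid ][ x ][ p ] (D u x p) (w u)
    eval-kid {σ} {u} x p good kid≡ = eval-dp {σ} {kid} {x} {p} u kid≡ (good x p) (D≤w u x p) (w≤n u)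

    -- The accumulator plus the contribution of the unscanned children is constant, and its bound
    -- `k` plus their weights stays at most `n`. For type `S` the sum starts at 1, which is why
    -- `w-kids` has a successor.
    Accumulates : (ChildTable → ℕ ₋) → ℕ ₋ → List (Fin n) → State → Set
    Accumulates G total us σ = ∃[ A ] ∃[ k ]
      σ acc 0 ≡ encode A × A ≤₋ [ k ] × k + sum (map w us) ≤ n ×
      A ⊹ sumOf G (map D us) ≡ total × AllFilled us σ

    run-accumulate : (g : Expr) (G : ChildTable → ℕ ₋) →
      (∀ {u σ} → Filled u σ → σ kid 0 ≡ toℕ u → Eval σ g (G (D u)) (w u)) →
      ∀ {total} v us {σ} → σ cur 0 ≡ toℕ v → Linked (σ next) (σ first (toℕ v)) us →
      Accumulates G total us σ →
      Run M (length us) (forChildren (acc ≔ var acc ⊞ g)) σ (λ σ′ → σ′ acc 0 ≡ encode total)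
    run-accumulate g G eval-g {total} v us cur≡ l inv = run-map
      (λ { (A , _ , acc≡ , _ , _ , total≡ , _) →
           trans acc≡ (cong encode (trans (sym (⊹-identityʳ A)) total≡)) })
      (run-forChildren (acc ≔ var acc ⊞ g) (Accumulates G total) refl refl (λ i → i) (λ i → i)
         body v us cur≡ l inv)
      where
      body : ∀ {u us σ} → Accumulates G total (u ∷ us) σ → σ kid 0 ≡ toℕ u →
             Run M 0 (acc ≔ var acc ⊞ g) σ (Accumulates G total us)
      body {u} {us} {σ} (A , k , acc≡ , A≤ , k≤ , total≡ , filled) kid≡
        with eval-⊞ {σ} {var acc} {g} (eval-var {σ} {acc} acc≡ A≤ k≤n) (eval-g {σ = σ} (filled (here refl)) kid≡) k≤n (w≤n u)
        where k≤n = ℕ.≤-trans (ℕ.m≤m+n k _) k≤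
      ... | eval eq fits sum≤ = run-≔ 0 _ 0<M refl fits eq
        (A ⊹ G (D u) , k + w u , refl , sum≤ ,
         subst (_≤ n) (sym (ℕ.+-assoc k (w u) _)) k≤ ,
         trans (⊹-assoc A _ _) total≡ , λ u∈ → filled (there u∈))

    -- Only the `S` entries of `v` are claimed, since its other entries may still hold arbitrary
    -- words. Complete rows survive, including a complete row of `v` itself.
    computeS-run : ∀ v {σ} → σ cur 0 ≡ toℕ v → Linked (σ next) (σ first (toℕ v)) (kids v) →
      AllFilled (kids v) σ →
      Run M (length (kids v)) computeS σ λ σ′ →
        (∀ p → σ′ (dp S p) (toℕ v) ≡ encode (D v S p)) × (∀ u → Filled u σ → Filled u σ′)
    computeS-run v {σ} cur≡ l filled =
      ((0<M , refl) , (2<M , refl)) ⟶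
      run-frame (run-accumulate DP[ kid ][ N ][ S ] (λ c → c N S) (λ {_} {σ} → eval-kid {σ} N S) v (kids v) cur≡ l
        ([ 1 ] , 1 , refl , ⊑-refl , w-kids v , sym (D-eq v S N) , filled)) ⨾ᵣ
      λ {σ₁} (acc≡ , fr) →
        let cur≡₁ = trans (cong (λ row → row 0) (fr cur refl)) cur≡
            at    = (0<M , subst (_< M) (sym cur≡₁) (vertex<M v)) , cur≡₁
            old   = λ u x p (good : Filled u σ) → trans (cong (λ row → row (toℕ u)) (fr (dp x p) refl)) (good x p)
            SS    = sym (cong encode (D-eq v S S))
            SR    = sym (cong encode (D-eq v S R))
        in (at , ((0<M , cell-fits acc≡ (D≤w v S N) (w≤n v)) , acc≡)) ⟶
           (at , (0<M , refl)) ⟶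
           run-≔ _ _ (proj₁ at) (proj₂ at) 0<M refl
             ((λ { S → trans (overwrite-here (toℕ v)) SS
                 ; N → overwrite-here (toℕ v)
                 ; R → trans (overwrite-here (toℕ v)) SR }) ,
              λ u good → λ
                { S S → overwrite {v = v} {u} (λ { refl → SS }) (old u S S good)
                ; S N → overwrite {v = v} {u} (λ { refl → refl }) (old u S N good)
                ; S R → overwrite {v = v} {u} (λ { refl → SR }) (old u S R good)
                ; N p → old u N p good
                ; R p → old u R p good })

    computeR-run : ∀ v {σ} → σ cur 0 ≡ toℕ v → Linked (σ next) (σ first (toℕ v)) (kids v) →
      AllFilled (kids v) σ →
      Run M (length (kids v)) computeR σ λ σ′ →
        (∀ p → σ′ (dp R p) (toℕ v) ≡ encode (D v R p)) × (∀ u → Filled u σ → Filled u σ′)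
    computeR-run v {σ} cur≡ l filled =
      ((0<M , refl) , (1<M , refl)) ⟶
      run-frame (run-accumulate (maxᵉ DP[ kid ][ N ][ R ] DP[ kid ][ R ][ R ]) (λ c → max (c N R) (c R R))
        (λ {u} {σ} good kid≡ → eval-max {σ} {DP[ kid ][ N ][ R ]} {DP[ kid ][ R ][ R ]}
           (eval-kid {σ} N R good kid≡) (eval-kid {σ} R R good kid≡) (w≤n u))
        v (kids v) cur≡ l
        ([ 0 ] , 0 , refl , ⊑-refl , ℕ.<⇒≤ (w-kids v) ,
         trans (⊹-identityˡ _) (sym (D-eq v R R)) , filled)) ⨾ᵣ
      λ {σ₁} (acc≡ , fr) →
        let cur≡₁ = trans (cong (λ row → row 0) (fr cur refl)) cur≡
            at    = (0<M , subst (_< M) (sym cur≡₁) (vertex<M v)) , cur≡₁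
            out   = (0<M , cell-fits acc≡ (D≤w v R R) (w≤n v)) , acc≡
            old   = λ u x p (good : Filled u σ) → trans (cong (λ row → row (toℕ u)) (fr (dp x p) refl)) (good x p)
            RS    = sym (cong encode (D-eq v R S))
            RN    = cong encode (trans (D-eq v R R) (sym (D-eq v R N)))
        in (at , out) ⟶
           (at , out) ⟶
           run-≔ _ _ (proj₁ at) (proj₂ at) 0<M refl
             ((λ { S → trans (overwrite-here (toℕ v)) RS
                 ; N → trans (overwrite-here (toℕ v)) RN
                 ; R → overwrite-here (toℕ v) }) ,
              λ u good → λ
                { R S → overwrite {v = v} {u} (λ { refl → RS }) (old u R S good)
                ; R N → overwrite {v = v} {u} (λ { refl → RN }) (old u R N good)
                ; R R → overwrite {v = v} {u} (λ { refl → refl }) (old u R R good)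
                ; S S → old u S S good
                ; S N → old u S N good
                ; S R → old u S R good
                ; N S → old u N S good
                ; N N → old u N N good
                ; N R → old u N R good })

    eval-extend : ∀ {σ u k} (b : Best) s r →
      σ (best false r) 0 ≡ encode (b false r) → σ (best s r) 0 ≡ encode (b s r) →
      σ (best s false) 0 ≡ encode (b s false) →
      (∀ s r → b s r ≤₋ [ k ]) → k + w u ≤ n → Filled u σ → σ kid 0 ≡ toℕ u →
      Eval σ (maxᵉ (var (best false r) ⊞ DP[ kid ][ S ][ N ])
             (maxᵉ (var (best s r) ⊞ DP[ kid ][ N ][ N ]) (var (best s false) ⊞ DP[ kid ][ R ][ N ])))
           (extendBest b (D u) s r) (k + w u)
    eval-extend {σ} {u} {k} b s r eq₁ eq₂ eq₃ b≤ k≤ good kid≡ =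
      eval-max {σ} {e₁} {maxᵉ e₂ e₃} (add S eq₁) (eval-max {σ} {e₂} {e₃} (add N eq₂) (add R eq₃) k≤) k≤
      where
      e₁ = var (best false r) ⊞ DP[ kid ][ S ][ N ]
      e₂ = var (best s r) ⊞ DP[ kid ][ N ][ N ]
      e₃ = var (best s false) ⊞ DP[ kid ][ R ][ N ]
      k≤n = ℕ.≤-trans (ℕ.m≤m+n k (w u)) k≤

      add : ∀ {s r} x → σ (best s r) 0 ≡ encode (b s r) →
            Eval σ (var (best s r) ⊞ DP[ kid ][ x ][ N ]) (b s r ⊹ D u x N) (k + w u)
      add {s} {r} x eq = eval-⊞ {σ} {var (best s r)} {DP[ kid ][ x ][ N ]}
        (eval-var {σ} {best s r} eq (b≤ s r) k≤n) (eval-kid {σ} x N good kid≡) k≤n (w≤n u)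

    BestCells : Best → State → Set
    BestCells b σ =
      σ (best true  true)  0 ≡ encode (b true  true)  × σ (best true  false) 0 ≡ encode (b true  false) ×
      σ (best false true)  0 ≡ encode (b false true)  × σ (best false false) 0 ≡ encode (b false false)

    Extends : Best → List (Fin n) → State → Set
    Extends total us σ = ∃[ b ] ∃[ k ] BestCells b σ × (∀ s r → b s r ≤₋ [ k ]) × k + sum (map w us) ≤ n ×
      bestOf b (map D us) ≡ total × AllFilled us σ

    extendAll : Stmt
    extendAll = extend true true ⨾ extend true false ⨾ extend false true ⨾ extend false false

    -- The equations about the initial cells still serve in `σ₁`, `σ₂` and `σ₃`: with more demands
    -- updated before fewer, no cell is read after it has been overwritten.
    extendAll-run : ∀ {total u us σ} → Extends total (u ∷ us) σ → σ kid 0 ≡ toℕ u →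
                    Run M 0 extendAll σ (Extends total us)
    extendAll-run {total} {u} {us} {σ} (b , k , (tt≡ , tf≡ , ft≡ , ff≡) , b≤ , k≤ , total≡ , filled) kid≡ =
      into (ev σ  true  true  ft≡ tt≡ tf≡ good kid≡) ⟶
      into (ev σ₁ true  false ff≡ tf≡ tf≡ good kid≡) ⟶
      into (ev σ₂ false true  ft≡ ft≡ ff≡ good kid≡) ⟶
      let ((f , p) , (f′ , p′)) = into (ev σ₃ false false ff≡ ff≡ ff≡ good kid≡)
      in run-≔ 0 _ f p f′ p′
        (b′ , k + w u , (refl , refl , refl , refl) , b′≤ ,
         subst (_≤ n) (sym (ℕ.+-assoc k (w u) _)) k≤ , total≡ , λ u∈ → filled (there u∈))
      where
      good = filled (here refl)
      b′   = extendBest b (D u)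
      σ₁   = write (best true  true)  0 (encode (b′ true  true))  σ
      σ₂   = write (best true  false) 0 (encode (b′ true  false)) σ₁
      σ₃   = write (best false true)  0 (encode (b′ false true))  σ₂

      ev : ∀ σ s r → _
      ev σ s r = λ eq₁ eq₂ eq₃ → eval-extend {σ} {u} {k} b s r eq₁ eq₂ eq₃ b≤
        (ℕ.≤-trans (ℕ.m≤m+n (k + w u) _) (subst (_≤ n) (sym (ℕ.+-assoc k (w u) _)) k≤))

      into : ∀ {σ e A k} → Eval σ e A k → (Fits M σ (lit 0) × 0 ≡ 0) × (Fits M σ e × ⟦ e ⟧ σ ≡ encode A)
      into (eval eq fits _) = (0<M , refl) , (fits , eq)

      b′≤ : ∀ s r → b′ s r ≤₋ [ k + w u ]
      b′≤ = extendBest-≤ {b} {D u} b≤ (λ x → D≤w u x N)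

    computeN-run : ∀ v {σ} → σ cur 0 ≡ toℕ v → Linked (σ next) (σ first (toℕ v)) (kids v) →
      AllFilled (kids v) σ →
      Run M (length (kids v)) computeN σ λ σ′ →
        (∀ p → σ′ (dp N p) (toℕ v) ≡ encode (D v N p)) × (∀ u → Filled u σ → Filled u σ′)
    computeN-run v {σ} cur≡ l filled =
      ((0<M , refl) , (1<M , refl)) ⟶
      ((0<M , refl) , (0<M , refl)) ⟶
      ((0<M , refl) , (0<M , refl)) ⟶
      ((0<M , refl) , (0<M , refl)) ⟶
      run-frame (run-forChildren extendAll (Extends (bestOf emptyBest (map D (kids v)))) refl refl (λ i → i) (λ i → i)
        (λ {u} {us} {σ} → extendAll-run {us = us} {σ}) v (kids v) cur≡ l
        (emptyBest , 0 , (refl , refl , refl , refl) , emptyBest≤ , ℕ.<⇒≤ (w-kids v) , refl , filled)) ⨾ᵣ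
      λ { {σ₁} ((b , _ , (tt≡ , tf≡ , ft≡ , _) , _ , _ , total≡ , _) , fr) →
        let cur≡₁ = trans (cong (λ row → row 0) (fr cur refl)) cur≡
            at    = (0<M , subst (_< M) (sym cur≡₁) (vertex<M v)) , cur≡₁
            out   = λ {x} p s r (eq : x ≡ encode (b s r)) (entry≡ : D v N p ≡ bestOf emptyBest (map D (kids v)) s r) →
                      trans eq (cong encode (trans (cong (λ b → b s r) total≡) (sym entry≡)))
            NS    = out S false true  ft≡ (D-eq v N S)
            NN    = out N true  true  tt≡ (D-eq v N N)
            NR    = out R true  false tf≡ (D-eq v N R)
            fits  = λ {x} p (eq : x ≡ encode (D v N p)) → 0<M , cell-fits eq (D≤w v N p) (w≤n v)
            old   = λ u x p (good : Filled u σ) → trans (cong (λ row → row (toℕ u)) (fr (dp x p) refl)) (good x p)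
        in (at , (fits S NS , NS)) ⟶
           (at , (fits N NN , NN)) ⟶
           run-≔ _ _ (proj₁ at) (proj₂ at) (fits R NR) NR
             ((λ { S → overwrite-here (toℕ v)
                 ; N → overwrite-here (toℕ v)
                 ; R → overwrite-here (toℕ v) }) ,
              λ u good → λ
                { N S → overwrite {v = v} {u} (λ { refl → refl }) (old u N S good)
                ; N N → overwrite {v = v} {u} (λ { refl → refl }) (old u N N good)
                ; N R → overwrite {v = v} {u} (λ { refl → refl }) (old u N R good)
                ; S S → old u S S good
                ; S N → old u S N good
                ; S R → old u S R good
                ; R p → old u R p good }) }

-- Correctness of the recurrences

any-map⁺ : ∀ {A : Set} {x : Type} (a : List (A × Type)) → x ∈ map proj₂ a → Uses x a
any-map⁺ (_ ∷ a) (here eq)  = here (sym eq)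
any-map⁺ (_ ∷ a) (there x∈) = there (any-map⁺ a x∈)

any-map⁻ : ∀ {A : Set} {x : Type} {a : List (A × Type)} → Uses x a → x ∈ map proj₂ a
any-map⁻ (here eq) = here (sym eq)
any-map⁻ (there u) = there (any-map⁻ u)

indicator : Type → ℕ
indicator S = 1
indicator N = 0
indicator R = 0

-- The neighbourhood condition at a vertex of type `x`, split between the parent type `p` and the
-- child types `xs`, as (A), (B) and (C) require it.
Local : Type → Type → List Type → Set
Local S p xs = p ≡ N × (∀ {x} → x ∈ xs → x ≡ N)
Local N p xs = (p ≢ S → S ∈ xs) × (p ≢ R → R ∈ xs)
Local R p xs = p ≢ S × (∀ {x} → x ∈ xs → x ≢ S)

module Correctness {n : ℕ} (T : RootedTree n) (DP : Table n) (isDPTable : IsDPTable T DP) where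
  open RootedTree T renaming (root to r)
  open IsDPTable isDPTable
  open Rooted T
  open Descent T children (λ _ → ↭-refl)

  Labelling : Set
  Labelling = Fin n → Type

  count : Labelling → List (Fin n) → ℕ
  count τ vs = sum (map (indicator ∘ τ) vs)

  count-++ : ∀ τ xs ys → count τ (xs ++ ys) ≡ count τ xs + count τ ys
  count-++ τ xs ys = trans (cong sum (map-++ (indicator ∘ τ) xs ys)) (sum-++ (map (indicator ∘ τ) xs) _)

  count-post : ∀ τ v → count τ (post v) ≡ indicator (τ v) + count τ (concatMap post (children v))
  count-post τ v = trans (cong (count τ) (post-unfold v))
    (trans (count-++ τ (concatMap post (children v)) (v ∷ []))
      (trans (ℕ.+-comm (count τ (concatMap post (children v))) _)
        (cong (_+ count τ (concatMap post (children v))) (ℕ.+-identityʳ (indicator (τ v))))))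

  At : Labelling → Fin n → Type → Set
  At τ v p = Local (τ v) p (map τ (children v))

  -- A parent of type N is compatible with every type and never supplies the S or
  -- the R that a vertex of type N needs, so the root is given one.
  ParentType : Labelling → Fin n → Type → Set
  ParentType τ v p = (v ≡ r × p ≡ N) ⊎ (∃[ q ] IsChildOf v q × p ≡ τ q)

  Consistent : Labelling → Set
  Consistent τ = ∀ v p → ParentType τ v p → At τ v p

  chosen : (Fin n → Type) → List (Fin n) → Assignment (Fin n)
  chosen f = map (λ u → u , f u)

  chosen-proj₁ : ∀ f us → map proj₁ (chosen f us) ≡ us
  chosen-proj₁ f us = trans (sym (map-∘ us)) (map-id us)

  chosen-proj₂ : ∀ f us → map proj₂ (chosen f us) ≡ map f us
  chosen-proj₂ f us = sym (map-∘ us)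

  total : Type → Assignment (Fin n) → ℕ ₋
  total p = sumOf (λ ux → DP (proj₁ ux) (proj₂ ux) p)

  -- One step of the recurrences dominates every locally correct choice of child types;
  -- `local-lower` provides a choice attaining it.
  local-upper : ∀ τ v x p → Local x p (map τ (children v)) →
    [ indicator x ] ⊹ sumOf (λ u → DP u (τ u) x) (children v) ≤₋ DP v x p
  local-upper τ v S .N (refl , allN) = ⊑-reflexive (trans
    (cong ([ 1 ] ⊹_) (sumOf-cong (children v) λ u∈ → cong (λ x → DP _ x S) (allN (∈-map⁺ τ u∈))))
    (sym (typeS v)))
  local-upper τ v N p (s , t) = subst (_≤₋ DP v N p)
    (trans (sumOf-map _ (λ u → u , τ u) (children v)) (sym (⊹-identityˡ _)))
    (subst (total N (chosen τ (children v)) ≤₋_) (sym (typeN v p))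
      (maximum-⊑ (∈-map⁺ (total N) (∈-filter⁺ (admissible? p)
        (subst (λ us → chosen τ (children v) ∈ assignments us) (chosen-proj₁ τ (children v))
          (∈-assignments⁺ (chosen τ (children v))))
        (uses S ∘ s , uses R ∘ t)))))
    where
    uses : ∀ x → x ∈ map τ (children v) → Uses x (chosen τ (children v))
    uses x x∈ = any-map⁺ _ (subst (x ∈_) (sym (chosen-proj₂ τ (children v))) x∈)
  local-upper τ v R p (p≢S , noS) = subst (_≤₋ DP v R p) (sym (⊹-identityˡ _))
    (subst (sumOf (λ u → DP u (τ u) R) (children v) ≤₋_) (sym (typeR v p (p∈NR p p≢S)))
      (sumOf-mono (children v) λ {u} u∈ → pick u (τ u) (noS (∈-map⁺ τ u∈))))
    where
    p∈NR : ∀ p → p ≢ S → p ≡ N ⊎ p ≡ R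
    p∈NR S p≢S = ⊥-elim (p≢S refl)
    p∈NR N _   = inj₁ refl
    p∈NR R _   = inj₂ refl

    pick : ∀ u x → x ≢ S → DP u x R ≤₋ max (DP u N R) (DP u R R)
    pick u S x≢S = ⊥-elim (x≢S refl)
    pick u N _   = max-⊑ˡ _ _
    pick u R _   = max-⊑ʳ (DP u N R) _

  count≤DP : ∀ τ → Consistent τ → ∀ v p → ParentType τ v p → [ count τ (post v) ] ≤₋ DP v (τ v) p
  count≤DP τ consistent =
    kids-induction (λ v → ∀ p → ParentType τ v p → [ count τ (post v) ] ≤₋ DP v (τ v) p) λ v ih p pt →
      subst (λ k → [ k ] ≤₋ DP v (τ v) p) (sym (count-post τ v))
        (⊑-trans (⊹-mono {[ indicator (τ v) ]} ⊑-refl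
                   (posts (τ v) (children v) λ u∈ → ih u∈ (τ v) (inj₂ (v , ∈kids⁻ u∈ , refl))))
          (local-upper τ v (τ v) p (consistent v p pt)))
    where
    posts : ∀ x us → (∀ {u} → u ∈ us → [ count τ (post u) ] ≤₋ DP u (τ u) x) →
            [ count τ (concatMap post us) ] ≤₋ sumOf (λ u → DP u (τ u) x) us
    posts x []       _ = ⊑-refl
    posts x (u ∷ us) b = subst (λ k → [ k ] ≤₋ _) (sym (count-++ τ (post u) _))
      (⊹-mono (b (here refl)) (posts x us (b ∘ there)))

  -- Finiteness of the entry excludes the impossible states. For type `N` the choice is an
  -- assignment attaining the maximum, for type `R` the better of `N` and `R` at each child
  -- separately.
  local-lower : ∀ v x p {k} → DP v x p ≡ [ k ] → ∃[ a ] map proj₁ a ≡ children v ×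
    Local x p (map proj₂ a) × [ indicator x ] ⊹ total x a ≡ [ k ]
  local-lower v S S eq with () ← trans (sym eq) (proj₁ (impossible v))
  local-lower v S R eq with () ← trans (sym eq) (proj₁ (proj₂ (impossible v)))
  local-lower v S N eq = chosen (λ _ → N) (children v) , chosen-proj₁ _ (children v) ,
    (refl , λ x∈ → constant (subst (_ ∈_) (chosen-proj₂ _ (children v)) x∈)) ,
    trans (cong ([ 1 ] ⊹_) (sumOf-map _ _ (children v))) (trans (sym (typeS v)) eq)
    where
    constant : ∀ {x} → x ∈ map (λ _ → N) (children v) → x ≡ N
    constant x∈ = proj₂ (proj₂ (∈-map⁻ (λ _ → N) x∈))
  local-lower v N p {k} eq
    with ∈-map⁻ (total N) (maximum-attained _ (trans (sym (typeN v p)) eq))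
  ... | a , a∈ , k≡ with ∈-filter⁻ (admissible? p) {xs = assignments (children v)} a∈
  ... | a∈′ , s , t = a , ∈-assignments⁻ (children v) a∈′ ,
    (any-map⁻ ∘ s , any-map⁻ ∘ t) , trans (⊹-identityˡ _) (sym k≡)
  local-lower v R p {k} eq = chosen f (children v) , chosen-proj₁ f (children v) ,
    (p≢S , λ x∈ → f≢S (subst (_ ∈_) (chosen-proj₂ f (children v)) x∈)) ,
    trans (⊹-identityˡ _) (trans (sumOf-map _ _ (children v))
      (trans (sumOf-cong (children v) λ {u} _ → sym (proj₂ (proj₂ (best-of u)))) (trans (sym (sumEq p p≢S)) eq)))
    where
    best-of : ∀ u → ∃[ x ] x ≢ S × max (DP u N R) (DP u R R) ≡ DP u x R
    best-of u with max-sel (DP u N R) (DP u R R)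
    ... | inj₁ m = N , (λ ()) , m
    ... | inj₂ m = R , (λ ()) , m

    f : Fin n → Type
    f u = proj₁ (best-of u)

    f≢S : ∀ {x} → x ∈ map f (children v) → x ≢ S
    f≢S x∈ with ∈-map⁻ f x∈
    ... | u , _ , refl = proj₁ (proj₂ (best-of u))

    p≢S : p ≢ S
    p≢S refl with () ← trans (sym eq) (proj₂ (proj₂ (impossible v)))

    sumEq : ∀ p → p ≢ S → DP v R p ≡ sumOf (λ u → max (DP u N R) (DP u R R)) (children v)
    sumEq S p≢S = ⊥-elim (p≢S refl)
    sumEq N _   = typeR v N (inj₁ refl)
    sumEq R _   = typeR v R (inj₂ refl)

  -- Gluing labellings of disjoint subtrees

  Agree : List (Fin n) → Labelling → Labelling → Set
  Agree ws τ τ′ = ∀ {w} → w ∈ ws → τ w ≡ τ′ w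

  -- The conditions whose parent label lies in `ws`. The one at the top of a subtree is kept apart,
  -- as its parent lies outside.
  Inner : Labelling → List (Fin n) → Set
  Inner τ ws = ∀ {w u} → w ∈ ws → u ∈ children w → At τ u (τ w)

  Closed : List (Fin n) → Set
  Closed ws = ∀ {w u} → w ∈ ws → u ∈ children w → u ∈ ws

  posts-closed : ∀ us → Closed (concatMap post us)
  posts-closed us w∈ u∈ with ∈posts⁻ us w∈
  ... | x , x∈ , w∈x = ∈posts⁺ x∈ (post-closed x w∈x u∈)

  at-resp : ∀ {ws τ τ′ u p} → Closed ws → Agree ws τ τ′ → u ∈ ws → At τ u p → At τ′ u p
  at-resp {p = p} closed agree u∈ = subst₂ (λ x xs → Local x p xs) (agree u∈)
    (map-cong-local (tabulateAll λ c∈ → agree (closed u∈ c∈)))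

  inner-resp : ∀ {ws τ τ′} → Closed ws → Agree ws τ τ′ → Inner τ ws → Inner τ′ ws
  inner-resp {τ′ = τ′} closed agree inner w∈ u∈ =
    subst (At τ′ _) (agree w∈) (at-resp closed agree (closed w∈ u∈) (inner w∈ u∈))

  count-resp : ∀ {ws τ τ′} → Agree ws τ τ′ → count τ ws ≡ count τ′ ws
  count-resp agree = cong sum (map-cong-local (tabulateAll λ w∈ → cong indicator (agree w∈)))

  glue : List (Fin n) → Labelling → Labelling → Labelling
  glue ws τ τ′ w = if does (mem? Fin._≟_ w ws) then τ w else τ′ w

  glue-in : ∀ ws τ τ′ {w} → w ∈ ws → τ w ≡ glue ws τ τ′ w
  glue-in ws _ _ {w} w∈ with mem? Fin._≟_ w ws
  ... | yes _  = refl
  ... | no  w∉ = ⊥-elim (w∉ w∈)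

  glue-out : ∀ ws τ τ′ {w} → ¬ w ∈ ws → τ′ w ≡ glue ws τ τ′ w
  glue-out ws _ _ {w} w∉ with mem? Fin._≟_ w ws
  ... | yes w∈ = ⊥-elim (w∉ w∈)
  ... | no  _  = refl

  Realised : Fin n → Type → Type → ℕ → Set
  Realised v x p k = ∃[ τ ] τ v ≡ x × At τ v p × Inner τ (post v) × count τ (post v) ≡ k

  ⊹-split : ∀ A B {k} → A ⊹ B ≡ [ k ] → ∃[ a ] ∃[ b ] A ≡ [ a ] × B ≡ [ b ] × a + b ≡ k
  ⊹-split [ a ] [ b ] refl = a , b , refl , refl , refl

  -- A finite sum has finite summands, so every child subtree is realised by itself. Disjointness
  -- lets the labellings be glued, and the conditions survive because each subtree contains all
  -- labels they read.
  realise-forest : ∀ us → Unique (concatMap post us) →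
    (∀ {u} → u ∈ us → ∀ x p {k} → DP u x p ≡ [ k ] → Realised u x p k) →
    ∀ a p {k} → map proj₁ a ≡ us → total p a ≡ [ k ] →
    ∃[ τ ] map τ us ≡ map proj₂ a × (∀ {u} → u ∈ us → At τ u p) ×
      Inner τ (concatMap post us) × count τ (concatMap post us) ≡ k
  realise-forest [] _ _ [] p _ refl = (λ _ → N) , refl , (λ ()) , (λ ()) , refl
  realise-forest (u ∷ us) uniq ih ((_ , x) ∷ a) p refl sum≡
    with ⊹-split (DP u x p) _ sum≡ | unique-++⁻ (post u) uniq
  ... | _ , _ , eq₁ , eq₂ , k≡ | _ , uniq′ , disjoint
    with ih (here refl) x p eq₁ | realise-forest us uniq′ (ih ∘ there) a p refl eq₂
  ... | τ₁ , τ₁u≡ , at₁ , inner₁ , count₁ | τ₂ , τ₂≡ , at₂ , inner₂ , count₂ =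
    τ , cong₂ _∷_ (trans (sym (agree₁ (self∈post u))) τ₁u≡)
          (trans (map-cong-local (tabulateAll λ {c} c∈ → sym (agree₂ (∈posts⁺ c∈ (self∈post c))))) τ₂≡) ,
    (λ { (here refl) → at-resp (post-closed u) agree₁ (self∈post u) at₁
       ; (there c∈)  → at-resp (posts-closed us) agree₂ (∈posts⁺ c∈ (self∈post _)) (at₂ c∈) }) ,
    inner ,
    trans (count-++ τ (post u) _)
      (trans (cong₂ _+_ (trans (sym (count-resp agree₁)) count₁) (trans (sym (count-resp agree₂)) count₂)) k≡)
    where
    τ : Labelling
    τ = glue (post u) τ₁ τ₂

    agree₁ : Agree (post u) τ₁ τ
    agree₁ = glue-in (post u) τ₁ τ₂

    agree₂ : Agree (concatMap post us) τ₂ τ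
    agree₂ w∈ = glue-out (post u) τ₁ τ₂ λ w∈u → disjoint w∈u w∈

    inner : Inner τ (post u ++ concatMap post us)
    inner w∈ c∈ with ∈-++⁻ (post u) w∈
    ... | inj₁ w∈u  = inner-resp (post-closed u) agree₁ inner₁ w∈u c∈
    ... | inj₂ w∈us = inner-resp (posts-closed us) agree₂ inner₂ w∈us c∈

  realise : ∀ v x p {k} → DP v x p ≡ [ k ] → Realised v x p k
  realise = kids-induction (λ v → ∀ x p {k} → DP v x p ≡ [ k ] → Realised v x p k) realise-node
    where
    realise-node : ∀ v → (∀ {u} → u ∈ children v → ∀ x p {k} → DP u x p ≡ [ k ] → Realised u x p k) →
           ∀ x p {k} → DP v x p ≡ [ k ] → Realised v x p k
    realise-node v ih x p eq with local-lower v x p eq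
    ... | a , a≡ , local , sum≡ with ⊹-split [ indicator x ] _ sum≡
    ... | _ , _ , refl , eq′ , k≡
      with realise-forest (children v) (posts-unique (children v) (children-unique v) (λ u∈ → u∈) λ {u} _ → post-unique u)
             ih a x a≡ eq′
    ... | τ₀ , τ₀≡ , at₀ , inner₀ , count₀ =
      τ , τv≡ , subst₂ (λ y xs → Local y p xs) (sym τv≡) (trans (sym τ₀≡) kids≡) local ,
      inner ,
      trans (count-post τ v) (trans (cong₂ _+_ (cong indicator τv≡) (trans (sym (count-resp agree)) count₀)) k≡)
      where
      τ : Labelling
      -- `τ₀` is constrained only below `v`, so its value at `v` may be replaced by `x`.
      τ = glue (v ∷ []) (λ _ → x) τ₀

      τv≡ : τ v ≡ x
      τv≡ = sym (glue-in (v ∷ []) (λ _ → x) τ₀ (here refl))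

      agree : Agree (concatMap post (children v)) τ₀ τ
      agree w∈ = glue-out (v ∷ []) (λ _ → x) τ₀ λ { (here refl) → ∉posts-kids v w∈ }

      kids≡ : map τ₀ (children v) ≡ map τ (children v)
      kids≡ = map-cong-local (tabulateAll λ {u} u∈ → agree (∈posts⁺ u∈ (self∈post u)))

      inner : Inner τ (post v)
      inner w∈ c∈ with ∈-++⁻ (concatMap post (children v)) (subst (_ ∈_) (post-unfold v) w∈)
      ... | inj₁ w∈′ = inner-resp (posts-closed (children v)) agree inner₀ w∈′ c∈
      ... | inj₂ (here refl) = subst (At τ _) (sym τv≡)
        (at-resp (posts-closed (children v)) agree (∈posts⁺ c∈ (self∈post _)) (at₀ c∈))

  realised⇒consistent : ∀ {τ} → At τ r N → Inner τ (post r) → Consistent τ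
  realised⇒consistent at inner v p (inj₁ (refl , refl))    = at
  realised⇒consistent at inner v p (inj₂ (q , c , refl)) = inner (∈post-root q) (∈kids⁺ c)

  -- Labellings of the whole tree and ESI-sets

  Valid : Labelling → Set
  Valid τ = ∀ v →
    (τ v ≡ S → ∀ u → Adj v u → τ u ≡ N) ×
    (τ v ≡ R → ∀ u → Adj v u → τ u ≢ S) ×
    (τ v ≡ N → (∃[ u ] Adj v u × τ u ≡ S) × (∃[ u ] Adj v u × τ u ≡ R))

  parentType : ∀ τ v → ∃[ p ] ParentType τ v p
  parentType τ v with parent v
  ... | inj₁ v≡r     = N , inj₁ (v≡r , refl)
  ... | inj₂ (q , c) = τ q , inj₂ (q , c , refl)

  neighbour : ∀ {τ v p u} → ParentType τ v p → Adj v u → (τ u ∈ map τ (children v)) ⊎ (τ u ≡ p)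
  neighbour {τ} pt e with adj⇒child e
  neighbour {τ} pt e | inj₂ u-child = inj₁ (∈-map⁺ τ (∈kids⁺ u-child))
  neighbour (inj₁ (refl , _))        e | inj₁ v-child = ⊥-elim (root-orphan v-child)
  neighbour {τ} (inj₂ (q , c , refl)) e | inj₁ v-child = inj₂ (cong τ (parent-unique v-child c))

  child-label : ∀ (τ : Labelling) {v x} → x ∈ map τ (children v) → ∃[ u ] Adj v u × τ u ≡ x
  child-label τ x∈ with ∈-map⁻ τ x∈
  ... | u , u∈ , refl = u , proj₁ (∈kids⁻ u∈) , refl

  consistent⇒valid : ∀ {τ} → Consistent τ → Valid τ
  consistent⇒valid {τ} consistent v with parentType τ v
  ... | p , pt with τ v | consistent v p pt
  ... | S | p≡N , allN = (λ _ u e → step u e) , (λ ()) , λ ()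
    where
    step : ∀ u → Adj v u → τ u ≡ N
    step u e with neighbour {τ} pt e
    ... | inj₁ u∈ = allN u∈
    ... | inj₂ u≡ = trans u≡ p≡N
  ... | R | p≢S , noS = (λ ()) , (λ _ u e → step u e) , λ ()
    where
    step : ∀ u → Adj v u → τ u ≢ S
    step u e with neighbour {τ} pt e
    ... | inj₁ u∈ = noS u∈
    ... | inj₂ u≡ = λ eq → p≢S (trans (sym u≡) eq)
  ... | N | s , t = (λ ()) , (λ ()) , λ _ → find S (λ ()) s pt , find R (λ ()) t pt
    where
    -- A child is promised only when the parent type differs from `x`; otherwise the parent is the
    -- witness. It exists because the fictitious parent of the root has type `N`, which is not `x`.
    find : ∀ {p} x → N ≢ x → (p ≢ x → x ∈ map τ (children v)) → ParentType τ v p → ∃[ u ] Adj v u × τ u ≡ x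
    find {p} x N≢x child pt with p ≟ x
    ... | no  p≢x = child-label τ (child p≢x)
    find x N≢x child (inj₁ (_ , refl))     | yes refl = ⊥-elim (N≢x refl)
    find x N≢x child (inj₂ (q , c , refl)) | yes refl = q , symmetric (proj₁ c) , refl

  valid⇒consistent : ∀ {τ} → Valid τ → Consistent τ
  valid⇒consistent {τ} valid v p pt = local (τ v) refl
    where
    s = proj₁ (valid v)
    t = proj₁ (proj₂ (valid v))
    m = proj₂ (proj₂ (valid v))

    -- `P N` is for the fictitious parent of the root.
    parent-label : ∀ {p} (P : Type → Set) → P N → (∀ u → Adj v u → P (τ u)) → ParentType τ v p → P p
    parent-label P PN adj (inj₁ (_ , refl))     = PN
    parent-label P PN adj (inj₂ (q , c , refl)) = adj q (symmetric (proj₁ c))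

    child-labels : ∀ {x} (P : Type → Set) → (∀ u → Adj v u → P (τ u)) → x ∈ map τ (children v) → P x
    child-labels P adj x∈ with child-label τ x∈
    ... | u , e , refl = adj u e

    required : ∀ {x} → (∃[ u ] Adj v u × τ u ≡ x) → p ≢ x → x ∈ map τ (children v)
    required (u , e , refl) p≢ with neighbour {τ} pt e
    ... | inj₁ u∈ = u∈
    ... | inj₂ u≡ = ⊥-elim (p≢ (sym u≡))

    local : ∀ x → τ v ≡ x → Local x p (map τ (children v))
    local S eq = parent-label (_≡ N) refl (s eq) pt , child-labels (_≡ N) (s eq)
    local N eq = required (proj₁ (m eq)) , required (proj₂ (m eq))
    local R eq = parent-label (_≢ S) (λ ()) (t eq) pt , child-labels (_≢ S) (t eq)

  cardinality : ∀ {m} (B : Subset m) (g : Fin m → ℕ) → (∀ v → v ∈ₛ B → g v ≡ 1) →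
                (∀ v → ¬ v ∈ₛ B → g v ≡ 0) → ∣ B ∣ ≡ sum (List.tabulate g)
  cardinality Vec.[]            g _  _  = refl
  cardinality (true  Vec.∷ B) g g₁ g₀ = cong₂ _+_ (sym (g₁ Fin.zero Vec.here))
    (cardinality B (g ∘ Fin.suc) (λ v v∈ → g₁ (Fin.suc v) (Vec.there v∈))
      (λ v v∉ → g₀ (Fin.suc v) λ { (Vec.there v∈) → v∉ v∈ }))
  cardinality (false Vec.∷ B) g g₁ g₀ = cong₂ _+_ (sym (g₀ Fin.zero λ ()))
    (cardinality B (g ∘ Fin.suc) (λ v v∈ → g₁ (Fin.suc v) (Vec.there v∈))
      (λ v v∉ → g₀ (Fin.suc v) λ { (Vec.there v∈) → v∉ v∈ }))

  count-root : ∀ τ → count τ (post r) ≡ sum (List.tabulate (indicator ∘ τ))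
  count-root τ = trans (sum-↭ (↭-map⁺ (indicator ∘ τ) post-root↭))
    (cong sum (map-tabulate (λ v → v) (indicator ∘ τ)))

  card-count : ∀ B τ → (∀ v → v ∈ₛ B → τ v ≡ S) → (∀ v → τ v ≡ S → v ∈ₛ B) → ∣ B ∣ ≡ count τ (post r)
  card-count B τ ⇒ ⇐ = trans (cardinality B (indicator ∘ τ) (λ v v∈ → cong indicator (⇒ v v∈)) zeros)
    (sym (count-root τ))
    where
    zeros : ∀ v → ¬ v ∈ₛ B → indicator (τ v) ≡ 0
    zeros v v∉ with τ v in eq
    ... | S = ⊥-elim (v∉ (⇐ v eq))
    ... | N = refl
    ... | R = refl

  supportOf : Labelling → Subset n
  supportOf τ = Vec.tabulate λ v → does (τ v ≟ S)

  support⁻ : ∀ τ v → v ∈ₛ supportOf τ → τ v ≡ S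
  support⁻ τ v v∈ with τ v ≟ S | trans (sym (lookup∘tabulate (λ v → does (τ v ≟ S)) v)) ([]=⇒lookup v∈)
  ... | yes eq | _ = eq

  support⁺ : ∀ τ v → τ v ≡ S → v ∈ₛ supportOf τ
  support⁺ τ v eq = lookup⇒[]= v (supportOf τ)
    (trans (lookup∘tabulate (λ v → does (τ v ≟ S)) v) (cong (λ x → does (x ≟ S)) eq))

  valid⇒ESI : ∀ τ → Valid τ → IsESI graph (supportOf τ)
  valid⇒ESI τ valid = independent , supported
    where
    independent : Independent graph (supportOf τ)
    independent u v u∈ v∈ e
      with () ← trans (sym (proj₁ (valid u) (support⁻ τ u u∈) v e)) (support⁻ τ v v∈)

    supported : ∀ v → _∈N⟨_⟩ graph v (supportOf τ) → ∃[ w ] Adj v w × ¬ _∈N[_] graph w (supportOf τ)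
    supported v ((b , b∈ , inj₁ refl) , v∉) = ⊥-elim (v∉ b∈)
    supported v ((b , b∈ , inj₂ e) , v∉)
      with proj₂ (proj₂ (proj₂ (valid v)) (proj₁ (valid b) (support⁻ τ b b∈) v e))
    ... | w , f , w≡R = w , f , λ
      { (c , c∈ , inj₁ refl) → case (trans (sym w≡R) (support⁻ τ c c∈))
      ; (c , c∈ , inj₂ g)    → proj₁ (proj₂ (valid w)) w≡R c (symmetric g) (support⁻ τ c c∈) }
      where
      case : R ≡ S → ⊥
      case ()

  module _ (B : Subset n) where

    inClosed? : ∀ v → Dec (_∈N[_] graph v B)
    inClosed? v = Fin.any? λ b → (b ∈ₛ? B) ×-dec ((v Fin.≟ b) ⊎-dec adj? b v)

    typeOf : ∀ {P Q : Set} → Dec P → Dec Q → Type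
    typeOf (yes _) _       = S
    typeOf (no _)  (yes _) = N
    typeOf (no _)  (no _)  = R

    labelOf : Labelling
    labelOf v = typeOf (v ∈ₛ? B) (inClosed? v)

    Meaning : Fin n → Type → Set
    Meaning v S = v ∈ₛ B
    Meaning v N = _∈N⟨_⟩ graph v B
    Meaning v R = ¬ _∈N[_] graph v B

    meaning : ∀ v → Meaning v (labelOf v)
    meaning v with v ∈ₛ? B | inClosed? v
    ... | yes v∈ | _      = v∈
    ... | no  v∉ | yes v∈ = v∈ , v∉
    ... | no  _  | no  v∉ = v∉

    means : ∀ v x → labelOf v ≡ x → Meaning v x
    means v _ refl = meaning v

    labelS : ∀ v → v ∈ₛ B → labelOf v ≡ S
    labelS v v∈ with v ∈ₛ? B
    ... | yes _  = refl
    ... | no  v∉ = ⊥-elim (v∉ v∈)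

    labelN : ∀ v → _∈N⟨_⟩ graph v B → labelOf v ≡ N
    labelN v (v∈ , v∉) with v ∈ₛ? B | inClosed? v
    ... | yes v∈B | _     = ⊥-elim (v∉ v∈B)
    ... | no  _   | yes _ = refl
    ... | no  _   | no v∉N = ⊥-elim (v∉N v∈)

    labelR : ∀ v → ¬ _∈N[_] graph v B → labelOf v ≡ R
    labelR v v∉ with v ∈ₛ? B | inClosed? v
    ... | yes v∈ | _      = ⊥-elim (v∉ (v , v∈ , inj₁ refl))
    ... | no  _  | yes v∈ = ⊥-elim (v∉ v∈)
    ... | no  _  | no  _  = refl

    ESI⇒valid : IsESI graph B → Valid labelOf
    ESI⇒valid (independent , supported) v =
      (λ eq u e → labelN u ((v , means v S eq , inj₂ e) , λ u∈ → independent v u (means v S eq) u∈ e)) ,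
      (λ eq u e u≡S → means v R eq (u , means u S u≡S , inj₂ (symmetric e))) ,
      λ eq → dominated (means v N eq) , private-neighbour (supported v (means v N eq))
      where
      dominated : _∈N⟨_⟩ graph v B → ∃[ u ] Adj v u × labelOf u ≡ S
      dominated ((b , b∈ , inj₁ refl) , v∉) = ⊥-elim (v∉ b∈)
      dominated ((b , b∈ , inj₂ e)    , _)  = b , symmetric e , labelS b b∈

      private-neighbour : ∃[ w ] Adj v w × ¬ _∈N[_] graph w B → ∃[ u ] Adj v u × labelOf u ≡ R
      private-neighbour (w , e , w∉) = w , e , labelR w w∉

  ⊑-output : ∀ x → DP r x N ≤₋ output T DP
  ⊑-output S = max-⊑ˡ (DP r S N) _
  ⊑-output N = ⊑-trans (max-⊑ˡ (DP r N N) (DP r R N)) (max-⊑ʳ (DP r S N) _)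
  ⊑-output R = ⊑-trans (max-⊑ʳ (DP r N N) (DP r R N)) (max-⊑ʳ (DP r S N) _)

  output-attained : ∃[ x ] output T DP ≡ DP r x N
  output-attained with max-sel (DP r S N) (max (DP r N N) (DP r R N))
  ... | inj₁ eq = S , eq
  ... | inj₂ eq with max-sel (DP r N N) (DP r R N)
  ... | inj₁ eq′ = N , trans eq eq′
  ... | inj₂ eq′ = R , trans eq eq′

  valid⇒≤output : ∀ τ → Valid τ → [ count τ (post r) ] ≤₋ output T DP
  valid⇒≤output τ valid =
    ⊑-trans (count≤DP τ (valid⇒consistent valid) r N (inj₁ (refl , refl))) (⊑-output (τ r))

  ESI⇒≤output : ∀ B → IsESI graph B → [ ∣ B ∣ ] ≤₋ output T DP
  ESI⇒≤output B esi = subst (λ k → [ k ] ≤₋ output T DP)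
    (sym (card-count B (labelOf B) (labelS B) (λ v → means B v S)))
    (valid⇒≤output (labelOf B) (ESI⇒valid B esi))

  output-number : ∀ {α} → output T DP ≡ [ α ] → IsESINumber graph α
  output-number {α} eq with output-attained
  ... | x , x≡ with realise r x N (trans (sym x≡) eq)
  ... | τ , _ , at , inner , count≡ =
    (supportOf τ , valid⇒ESI τ (consistent⇒valid (realised⇒consistent at inner)) ,
      trans (card-count (supportOf τ) τ (support⁻ τ) (support⁺ τ)) count≡) ,
    λ B esi → [≤]-injective (subst ([ ∣ B ∣ ] ≤₋_) eq (ESI⇒≤output B esi))

  output-correct : ∃[ α ] output T DP ≡ [ α ] × IsESINumber graph α
  -- The labelling constantly `R`, which belongs to the empty ESI-set, is valid and shows that the
  -- output is not -∞.
  output-correct with output T DP in eq | valid⇒≤output (λ _ → R) (λ _ → (λ ()) , (λ _ _ _ ()) , λ ())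
  ... | [ α ] | _ = α , refl , output-number eq

-- The runs of the two passes over the tree

data StackAt {n} (row : ℕ → ℕ) : ℕ → List (Fin n) → Set where
  []   : StackAt row 0 []
  push : ∀ {k v st} → row k ≡ toℕ v → StackAt row k st → StackAt row (suc k) (v ∷ st)

stack-length : ∀ {n row k} {st : List (Fin n)} → StackAt row k st → length st ≡ k
stack-length []         = refl
stack-length (push _ s) = cong suc (stack-length s)

stack-write : ∀ {n row k i x} {st : List (Fin n)} → k ≤ i → StackAt row k st →
              StackAt (λ j → if j ≡ᵇ i then x else row j) k st
stack-write k≤ []          = []
stack-write k≤ (push eq s) =
  push (trans (overwrite-there (ℕ.<⇒≢ k≤)) eq) (stack-write (ℕ.<⇒≤ k≤) s)

data SegmentAt {n} (row : ℕ → ℕ) : ℕ → List (Fin n) → Set where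
  []  : ∀ {i} → SegmentAt row i []
  _∷_ : ∀ {i v vs} → row i ≡ toℕ v → SegmentAt row (suc i) vs → SegmentAt row i (v ∷ vs)

segment-write : ∀ {n row i j x} {vs : List (Fin n)} → j < i → SegmentAt row i vs →
                SegmentAt (λ k → if k ≡ᵇ j then x else row k) i vs
segment-write j< []       = []
segment-write j< (eq ∷ s) = trans (overwrite-there (ℕ.<⇒≢ j< ∘ sym)) eq ∷ segment-write (ℕ.m≤n⇒m≤1+n j<) s

segment⇒applyUpTo : ∀ {n row i} {vs : List (Fin n)} f → (∀ j → f j ≡ row (i + j)) → SegmentAt row i vs →
                    applyUpTo f (length vs) ≡ map toℕ vs
segment⇒applyUpTo f f≡ [] = refl
segment⇒applyUpTo {row = row} {i} f f≡ (eq ∷ s) = cong₂ _∷_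
  (trans (f≡ 0) (trans (cong row (ℕ.+-identityʳ i)) eq))
  (segment⇒applyUpTo (f ∘ suc) (λ j → trans (f≡ (suc j)) (cong row (ℕ.+-suc i j))) s)

rootedTree⇒1≤n : ∀ {n} → RootedTree n → 1 ≤ n
rootedTree⇒1≤n T = ℕ.≤-trans (s≤s z≤n) (Fin.toℕ<n (RootedTree.root T))

module Algorithm {n : ℕ} (T : RootedTree n) (kids : Fin n → List (Fin n))
                 (kids↭ : ∀ v → kids v ↭ RootedTree.children T v)
                 {M : ℕ} (room : 3 + (n + n) ≤ M) where
  open RootedTree T using () renaming (root to r)
  open Descent T kids kids↭

  1≤n : 1 ≤ n
  1≤n = rootedTree⇒1≤n T

  open Programs room 1≤n

  D : Fin n → ChildTable
  D = fold λ _ cs x p → entry x p cs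

  D-eq : ∀ v x p → D v x p ≡ entry x p (map D (kids v))
  D-eq v x p = cong-app (cong-app (fold-unfold _ v) x) p

  -- The size of the subtree, defined by `fold` so that it unfolds along the same child lists as
  -- `D`.
  w : Fin n → ℕ
  w = fold λ _ ws → suc (sum ws)

  w-eq : ∀ v → w v ≡ suc (sum (map w (kids v)))
  w-eq = fold-unfold _

  w≡length : ∀ v → w v ≡ length (post v)
  w≡length = kids-induction (λ v → w v ≡ length (post v)) λ v ih →
    trans (w-eq v) (trans (cong suc (go (kids v) ih))
      (trans (ℕ.+-comm 1 _) (trans (sym (length-++ (concatMap post (kids v)))) (cong length (sym (post-unfold v))))))
    where
    go : ∀ us → (∀ {u} → u ∈ us → w u ≡ length (post u)) → sum (map w us) ≡ length (concatMap post us)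
    go []       _  = refl
    go (u ∷ us) ih = trans (cong₂ _+_ (ih (here refl)) (go us (ih ∘ there))) (sym (length-++ (post u)))

  w≤n : ∀ v → w v ≤ n
  w≤n v = subst (_≤ n) (sym (w≡length v)) (unique⇒length≤ (post-unique v))

  w-kids : ∀ v → suc (sum (map w (kids v))) ≤ n
  w-kids v = subst (_≤ n) (w-eq v) (w≤n v)

  -- Only type `S` adds the vertex itself to the values of its children; for the other types one
  -- unit of `w v` is to spare.
  D≤w : ∀ v x p → D v x p ≤₋ [ w v ]
  D≤w = kids-induction (λ v → ∀ x p → D v x p ≤₋ [ w v ]) λ v ih x p →
    subst₂ (λ A k → A ≤₋ [ k ]) (sym (D-eq v x p)) (sym (w-eq v)) (entry≤ (kids v) ih x p)
    where
    Bounded : List (Fin n) → Set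
    Bounded us = ∀ {u} → u ∈ us → ∀ x p → D u x p ≤₋ [ w u ]

    sum≤ : ∀ us (G : ChildTable → ℕ ₋) → (∀ {u} → u ∈ us → G (D u) ≤₋ [ w u ]) →
           sumOf G (map D us) ≤₋ [ sum (map w us) ]
    sum≤ []       G b = ⊑-refl
    sum≤ (u ∷ us) G b = ⊹-mono (b (here refl)) (sum≤ us G (b ∘ there))

    bestOf≤ : ∀ us → Bounded us → ∀ b k → (∀ s r → b s r ≤₋ [ k ]) →
              ∀ s r → bestOf b (map D us) s r ≤₋ [ k + sum (map w us) ]
    bestOf≤ []       bd b k b≤ s r = subst (λ k → b s r ≤₋ [ k ]) (sym (ℕ.+-identityʳ k)) (b≤ s r)
    bestOf≤ (u ∷ us) bd b k b≤ s r =
      subst (λ k → bestOf b (map D (u ∷ us)) s r ≤₋ [ k ]) (ℕ.+-assoc k (w u) _)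
        (bestOf≤ us (bd ∘ there) (extendBest b (D u)) (k + w u)
          (λ s r → extendBest-≤ {b} {D u} {k} {w u} b≤ (λ x → bd (here refl) x N) s r) s r)

    suc≤ : ∀ {A k} → A ≤₋ [ k ] → A ≤₋ [ suc k ]
    suc≤ A≤ = ⊑-trans A≤ [ ℕ.n≤1+n _ ]

    entry≤ : ∀ us → Bounded us → ∀ x p → entry x p (map D us) ≤₋ [ suc (sum (map w us)) ]
    entry≤ us b S S = ⊥₋≤ _
    entry≤ us b S N = ⊹-mono {[ 1 ]} ⊑-refl (sum≤ us _ λ u∈ → b u∈ N S)
    entry≤ us b S R = ⊥₋≤ _
    entry≤ us b N p = suc≤ (bestOf≤ us b emptyBest 0 emptyBest≤ _ _)
    entry≤ us b R S = ⊥₋≤ _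
    entry≤ us b R N = suc≤ (sum≤ us _ λ u∈ → max-lub (b u∈ N R) (b u∈ R R))
    entry≤ us b R R = suc≤ (sum≤ us _ λ u∈ → max-lub (b u∈ N R) (b u∈ R R))

  open Tables kids D w D-eq D≤w w≤n w-kids

  -- Depth-first search

  Input : State → Set
  Input σ = σ size 0 ≡ n × σ root 0 ≡ toℕ r × (∀ v → Linked (σ next) (σ first (toℕ v)) (kids v))

  input-resp : ∀ {σ σ′} → σ′ size ≡ σ size → σ′ root ≡ σ root → σ′ first ≡ σ first → σ′ next ≡ σ next →
               Input σ → Input σ′
  input-resp s≡ r≡ f≡ n≡ (a , b , l) =
    trans (cong-app s≡ 0) a , trans (cong-app r≡ 0) b ,
    λ v → subst₂ (λ nx fr → Linked nx (fr (toℕ v)) (kids v)) (sym n≡) (sym f≡) (l v)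

  -- The final contents of order when ws is already written and st waits on the
  -- stack.
  unwind : List (Fin n) → List (Fin n) → List (Fin n)
  unwind []       ws = ws
  unwind (v ∷ st) ws = unwind st (post v ++ ws)

  -- Two reversals cancel: pushing puts the last child on top, and as `order` is filled from its
  -- end, the subtree popped earliest stands furthest right.
  unwind-push : ∀ us st ws → unwind (us ʳ++ st) ws ≡ unwind st (concatMap post us ++ ws)
  unwind-push []       st ws = refl
  unwind-push (u ∷ us) st ws = trans (unwind-push us (u ∷ st) ws)
    (cong (unwind st) (sym (++-assoc (post u) (concatMap post us) ws)))

  unwind-visit : ∀ v st ws → unwind (kids v ʳ++ st) (v ∷ ws) ≡ unwind (v ∷ st) ws
  unwind-visit v st ws = trans (unwind-push (kids v) st (v ∷ ws)) (cong (unwind st)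
    (trans (sym (++-assoc (concatMap post (kids v)) (v ∷ []) ws)) (cong (_++ ws) (sym (post-unfold v)))))

  -- Each waiting vertex will write at least itself. As the final list has length `n`, this keeps
  -- the stack from overflowing.
  unwind-length : ∀ st ws → length st + length ws ≤ length (unwind st ws)
  unwind-length []       ws = ℕ.≤-refl
  unwind-length (v ∷ st) ws = ℕ.≤-trans
    (subst (_≤ length st + length (post v ++ ws)) (ℕ.+-suc (length st) (length ws))
      (ℕ.+-monoʳ-≤ (length st) (subst (suc (length ws) ≤_) (sym (length-++ (post v)))
        (ℕ.+-monoˡ-≤ (length ws) (∈-length (self∈post v))))))
    (unwind-length st (post v ++ ws))

  pushKid : Stmt
  pushKid = stack ⟨ var top ⟩≔ var kid ⨾ top ≔ var top ⊕ lit 1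

  -- Moving the head of `us` onto `st` leaves `us ʳ++ st` unchanged, so the final stack can be fixed
  -- in advance as `goal`.
  Pushes : List (Fin n) → List (Fin n) → State → Set
  Pushes goal us σ = ∃[ st ] StackAt (σ stack) (σ top 0) st × us ʳ++ st ≡ goal × length us + length st ≤ n

  pushKid-run : ∀ {goal u us σ} → Pushes goal (u ∷ us) σ → σ kid 0 ≡ toℕ u → Run M 0 pushKid σ (Pushes goal us)
  pushKid-run {u = u} {us} {σ} (st , s , goal≡ , ≤n) kid≡ =
    (((0<M , top<M) , refl) , ((0<M , subst (_< M) (sym kid≡) (vertex<M u)) , kid≡)) ⟶
    run-≔ 0 (suc (σ top 0)) 0<M refl
      ((0<M , top<M) , 1<M , subst (_< M) (ℕ.+-comm 1 (σ top 0)) (1+n<M (s≤s top≤n))) (ℕ.+-comm (σ top 0) 1)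
      (u ∷ st , push (overwrite-here (σ top 0)) (stack-write ℕ.≤-refl s) , goal≡ ,
       subst (_≤ n) (sym (ℕ.+-suc (length us) (length st))) ≤n)
    where
    top≤n : σ top 0 ≤ n
    top≤n = subst (_≤ n) (stack-length s) (ℕ.≤-trans (ℕ.m≤n+m (length st) _) ≤n)

    top<M : σ top 0 < M
    top<M = 1+n<M (ℕ.m≤n⇒m≤1+n top≤n)

  visitTop : Stmt
  visitTop =
    top ≔ var top ⊖ lit 1 ⨾
    cur ≔ stack ⟨ var top ⟩ ⨾
    idx ≔ var idx ⊖ lit 1 ⨾
    order ⟨ var idx ⟩≔ var cur ⨾
    forChildren pushKid

  -- The vertices of ws have been written to the end of order, those of st
  -- wait on the stack.
  Searching : ℕ → List (Fin n) → List (Fin n) → State → Set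
  Searching i st ws σ = Input σ × σ idx 0 ≡ i × StackAt (σ stack) (σ top 0) st × SegmentAt (σ order) i ws

  visitTop-run : ∀ {i v st ws σ} → Searching (suc i) (v ∷ st) ws σ → suc i ≤ n →
    length (kids v) + length st ≤ n →
    Run M (length (kids v)) visitTop σ (Searching i (kids v ʳ++ st) (v ∷ ws))
  visitTop-run {i} {v} {st} {ws} {σ} ((size≡ , root≡ , links) , idx≡ , stk , seg) i<n ≤n
    with σ top 0 in top≡ | stk
  ... | suc k | push v≡ stk′ =
    ((0<M , refl) , (((0<M , subst (_< M) (sym top≡) (1+n<M (s≤s k≤n))) , 1<M) , cong (_∸ 1) top≡)) ⟶
    ((0<M , refl) , (((0<M , k<M) , subst (_< M) (sym v≡) (vertex<M v)) , v≡)) ⟶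
    ((0<M , refl) , (((0<M , subst (_< M) (sym idx≡) (1+n<M (ℕ.m≤n⇒m≤1+n i<n))) , 1<M) , cong (_∸ 1) idx≡)) ⟶
    (((0<M , 1+n<M (ℕ.m≤n⇒m≤1+n (ℕ.<⇒≤ i<n))) , refl) , ((0<M , vertex<M v) , refl)) ⟶
    run-map
      (λ { {σ′} ((_ , stk″ , refl , _) , fr) →
         input-resp {σ} {σ′} (fr size refl) (fr root refl) (fr first refl) (fr next refl) (size≡ , root≡ , links) ,
         cong-app (fr idx refl) 0 ,
         stk″ ,
         subst (λ row → SegmentAt row i (v ∷ ws)) (sym (fr order refl))
           (overwrite-here i ∷ segment-write ℕ.≤-refl seg) })
      (run-frame (run-forChildren pushKid (Pushes (kids v ʳ++ st)) refl refl (λ p → p) (λ p → p)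
        (λ {u} {us} {σ} → pushKid-run {us = us} {σ}) v (kids v) refl (links v)
        (st , stk′ , refl , ≤n)))
    where
    k≤n : k ≤ n
    k≤n = subst (_≤ n) (stack-length stk′) (ℕ.≤-trans (ℕ.m≤n+m (length st) _) ≤n)

    k<M : k < M
    k<M = 1+n<M (ℕ.m≤n⇒m≤1+n k≤n)

  -- The e vertices that are neither written nor on the stack pay for the pushes.
  search-run : ∀ i e st ws {σ} → Searching i st ws σ → i ≡ length st + e → i + length ws ≡ n →
    unwind st ws ≡ post r →
    Run M (i + e) (while (var top) visitTop) σ (λ σ′ → Input σ′ × SegmentAt (σ′ order) 0 (post r))
  search-run i e [] ws {σ} (input , _ , stk , seg) i≡ len ends with σ top 0 in top≡ | stk
  ... | zero | [] = run-stop (0<M , subst (_< M) (sym top≡) 0<M) top≡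
    (input , subst₂ (SegmentAt (σ order)) i≡0 ends seg)
    where
    i≡0 : i ≡ 0
    i≡0 = ℕ.+-cancelʳ-≡ (length ws) i 0
      (trans len (trans (sym length-post-root) (cong length (sym ends))))
  search-run zero e (_ ∷ _) ws _ () len ends
  search-run (suc i) e (v ∷ st) ws {σ} inv@(_ , _ , stk , _) i≡ len ends =
    run-more (ℕ.≤-reflexive budget)
      (run-loop {m = length (kids v)} (0<M , top<M) top≢0
        (visitTop-run {st = st} {ws} {σ} inv (subst (suc i ≤_) len (ℕ.m≤m+n (suc i) _)) (ℕ.≤-trans ahead i≤n))
        λ inv′ → search-run i e′ (kids v ʳ++ st) (v ∷ ws) inv′ i≡′
          (trans (ℕ.+-suc i (length ws)) len) ends′)
    where
    ends′ : unwind (kids v ʳ++ st) (v ∷ ws) ≡ post r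
    ends′ = trans (unwind-visit v st ws) ends

    i≤n : i ≤ n
    i≤n = subst (i ≤_) len (ℕ.m≤n⇒m≤1+n (ℕ.m≤m+n i _))

    -- Every vertex on the stack after this visit still needs a cell of `order`, and `i` of them are
    -- free.
    ahead : length (kids v) + length st ≤ i
    ahead = ℕ.+-cancelʳ-≤ (suc (length ws)) _ i
      (subst₂ _≤_ (cong (_+ suc (length ws)) (length-ʳ++ (kids v)))
        (trans (cong length ends′) (trans length-post-root (trans (sym len) (sym (ℕ.+-suc i (length ws))))))
        (unwind-length (kids v ʳ++ st) (v ∷ ws)))

    e′ : ℕ
    e′ = i ∸ (length (kids v) + length st)

    i≡″ : i ≡ length (kids v) + length st + e′
    i≡″ = sym (ℕ.m+[n∸m]≡n ahead)

    i≡′ : i ≡ length (kids v ʳ++ st) + e′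
    i≡′ = trans i≡″ (cong (_+ e′) (sym (length-ʳ++ (kids v))))

    e≡ : length (kids v) + e′ ≡ e
    e≡ = ℕ.+-cancelˡ-≡ (length st) _ e (trans
      (trans (sym (ℕ.+-assoc (length st) (length (kids v)) e′)) (cong (_+ e′) (ℕ.+-comm (length st) _)))
      (trans (sym i≡″) (ℕ.suc-injective i≡)))

    budget : suc (length (kids v)) + (i + e′) ≡ suc i + e
    budget = cong suc (trans (sym (ℕ.+-assoc (length (kids v)) i e′))
      (trans (cong (_+ e′) (ℕ.+-comm (length (kids v)) i))
        (trans (ℕ.+-assoc i (length (kids v)) e′) (cong (i +_) e≡))))

    top≡ : suc (length st) ≡ σ top 0
    top≡ = stack-length stk

    top<M : σ top 0 < M
    top<M = subst (_< M) top≡ (1+n<M (s≤s (ℕ.≤-trans (ℕ.m≤n+m (length st) _) (ℕ.≤-trans ahead i≤n))))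

    top≢0 : σ top 0 ≢ 0
    top≢0 eq = ℕ.0≢1+n (sym (trans top≡ eq))

  computePostorder-run : ∀ {σ} → Input σ →
    Run M (n + n) computePostorder σ (λ σ′ → Input σ′ × SegmentAt (σ′ order) 0 (post r))
  computePostorder-run {σ} input@(size≡ , root≡ , _) =
    ((0<M , refl) , ((0<M , subst (_< M) (sym root≡) (vertex<M r)) , root≡)) ⟶
    ((0<M , refl) , (1<M , refl)) ⟶
    ((0<M , refl) , ((0<M , subst (_< M) (sym size≡) (1+n<M (ℕ.n≤1+n n))) , size≡)) ⟶
    -- All vertices but the root are still unseen, so `e` starts at `n ∸ 1`.
    run-more (ℕ.+-monoʳ-≤ n (ℕ.m∸n≤m n 1))
      (search-run n (n ∸ 1) (r ∷ []) [] (input , refl , push refl [] , [])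
        (sym (ℕ.m+[n∸m]≡n 1≤n)) (ℕ.+-identityʳ n) (++-identityʳ (post r)))

  -- Filling the table in postorder

  fillVertex : Stmt
  fillVertex =
    cur ≔ order ⟨ var idx ⟩ ⨾
    computeS ⨾
    computeR ⨾
    computeN ⨾
    idx ≔ var idx ⊕ lit 1

  Filling : (Fin n → Set) → List (Fin n) → State → Set
  Filling Done vs σ = Input σ × (∃[ i ] σ idx 0 ≡ i × i + length vs ≡ n × SegmentAt (σ order) i vs) ×
    (∀ u → Done u → Filled u σ)

  fillVertex-run : ∀ {Done v vs σ} → (∀ {u} → u ∈ kids v → Done u) → Filling Done (v ∷ vs) σ →
    Run M (length (kids v)) fillVertex σ (Filling (λ u → Done u ⊎ u ≡ v) vs)
  fillVertex-run {Done} {v} {vs} {σ} done ((size≡ , root≡ , links) , (i , idx≡ , len , v≡ ∷ seg) , filled) =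
    ((0<M , refl) , (((0<M , subst (_< M) (sym idx≡) i<M) , subst (_< M) (sym at) (vertex<M v)) , at)) ⟶
    run-frame (computeS-run v {σ₀} refl (links v) (λ u∈ → filled _ (done u∈))) ⨾ᵣ λ {σ₁} ((S≡ , keep₁) , fr₁) →
    let cur₁   = cong-app (fr₁ cur refl) 0
        input₁ = input-resp {σ₀} {σ₁} (fr₁ size refl) (fr₁ root refl) (fr₁ first refl) (fr₁ next refl)
                   (size≡ , root≡ , links)
    in
    run-frame (computeR-run v {σ₁} cur₁ (proj₂ (proj₂ input₁) v)
      (λ {u} u∈ → keep₁ u (filled u (done u∈)))) ⨾ᵣ λ {σ₂} ((R≡ , keep₂) , fr₂) →
    let cur₂   = trans (cong-app (fr₂ cur refl) 0) cur₁
        input₂ = input-resp {σ₁} {σ₂} (fr₂ size refl) (fr₂ root refl) (fr₂ first refl) (fr₂ next refl) input₁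
    in
    run-frame (computeN-run v {σ₂} cur₂ (proj₂ (proj₂ input₂) v)
      (λ {u} u∈ → keep₂ u (keep₁ u (filled u (done u∈))))) ⨾ᵣ λ {σ₃} ((N≡ , keep₃) , fr₃) →
    let input₃ = input-resp {σ₂} {σ₃} (fr₃ size refl) (fr₃ root refl) (fr₃ first refl) (fr₃ next refl) input₂
        idx₃   = trans (cong-app (trans (fr₃ idx refl) (trans (fr₂ idx refl) (fr₁ idx refl))) 0) idx≡
        order₃ = trans (fr₃ order refl) (trans (fr₂ order refl) (fr₁ order refl))
        S₃     = λ p (eq₃ : σ₃ (dp S p) ≡ σ₂ (dp S p)) (eq₂ : σ₂ (dp S p) ≡ σ₁ (dp S p)) →
                   trans (cong-app (trans eq₃ eq₂) (toℕ v)) (S≡ p)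
        R₃     = λ p (eq₃ : σ₃ (dp R p) ≡ σ₂ (dp R p)) → trans (cong-app eq₃ (toℕ v)) (R≡ p)
        v-filled : Filled v σ₃
        v-filled = λ
          { S S → S₃ S (fr₃ (dp S S) refl) (fr₂ (dp S S) refl)
          ; S N → S₃ N (fr₃ (dp S N) refl) (fr₂ (dp S N) refl)
          ; S R → S₃ R (fr₃ (dp S R) refl) (fr₂ (dp S R) refl)
          ; R S → R₃ S (fr₃ (dp R S) refl)
          ; R N → R₃ N (fr₃ (dp R N) refl)
          ; R R → R₃ R (fr₃ (dp R R) refl)
          ; N p → N≡ p }
    in run-≔ 0 (suc i) 0<M refl
         ((0<M , subst (_< M) (sym idx₃) i<M) , 1<M , subst (λ k → k + 1 < M) (sym idx₃) i+1<M)
         (trans (cong (_+ 1) idx₃) (ℕ.+-comm i 1))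
         (input₃ ,
          (suc i , refl , trans (sym (ℕ.+-suc i (length vs))) len ,
            subst (λ row → SegmentAt row (suc i) vs) (sym order₃) seg) ,
          λ { u (inj₁ d) → keep₃ u (keep₂ u (keep₁ u (filled u d))) ; u (inj₂ refl) → v-filled })
    where
    σ₀ : State
    σ₀ = write cur 0 (toℕ v) σ

    i<n : i < n
    i<n = subst (suc i ≤_) len (subst (suc i ≤_) (sym (ℕ.+-suc i (length vs))) (s≤s (ℕ.m≤m+n i _)))

    i<M : i < M
    i<M = 1+n<M (ℕ.m≤n⇒m≤1+n (ℕ.<⇒≤ i<n))

    i+1<M : i + 1 < M
    i+1<M = 1+n<M (subst (_≤ suc n) (ℕ.+-comm 1 i) (ℕ.m≤n⇒m≤1+n i<n))

    at : σ order (σ idx 0) ≡ toℕ v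
    at = trans (cong (σ order) idx≡) v≡

  -- The child list is scanned three times per vertex but counted once, because consecutive loops
  -- share one allowance.
  iterations : List (Fin n) → ℕ
  iterations []       = 0
  iterations (v ∷ vs) = suc (length (kids v)) + iterations vs

  iterations≡ : ∀ vs → iterations vs ≡ length vs + kidCount vs
  iterations≡ []       = refl
  iterations≡ (v ∷ vs) = cong suc (trans (cong (length (kids v) +_) (iterations≡ vs))
    (trans (sym (ℕ.+-assoc (length (kids v)) (length vs) _))
      (trans (cong (_+ kidCount vs) (ℕ.+-comm (length (kids v)) (length vs)))
        (ℕ.+-assoc (length vs) (length (kids v)) _))))

  iterations-root : iterations (post r) ≤ n + n
  iterations-root = subst (_≤ n + n) (sym (iterations≡ (post r)))
    (ℕ.+-mono-≤ (ℕ.≤-reflexive length-post-root)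
      (ℕ.≤-trans (ℕ.n≤1+n _) (ℕ.≤-reflexive (trans (kidCount-post r) length-post-root))))

  fill-run : ∀ {Done} vs {σ} → KidsFirst Done vs → Filling Done vs σ →
    Run M (iterations vs) (while (var size ⊖ var idx) fillVertex) σ
      (λ σ′ → Input σ′ × (∀ u → Done u ⊎ u ∈ vs → Filled u σ′))
  fill-run [] {σ} _ (input , (i , idx≡ , len , _) , filled) =
    run-stop (fits , (0<M , subst (_< M) (sym idx≡) (1+n<M (ℕ.m≤n⇒m≤1+n i≤n))))
      (trans (cong₂ _∸_ (proj₁ input) idx≡) (ℕ.m≤n⇒m∸n≡0 n≤i))
      (input , λ { u (inj₁ d) → filled u d })
    where
    i≤n : i ≤ n
    i≤n = subst (i ≤_) len (ℕ.m≤m+n i 0)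

    n≤i : n ≤ i
    n≤i = ℕ.≤-reflexive (trans (sym len) (ℕ.+-identityʳ i))

    fits : Fits M σ (var size)
    fits = 0<M , subst (_< M) (sym (proj₁ input)) (1+n<M (ℕ.n≤1+n n))
  fill-run (v ∷ vs) {σ} (kf , kfs) inv@(input , (i , idx≡ , len , _) , _) =
    run-loop {m = length (kids v)} (fits , (0<M , subst (_< M) (sym idx≡) (1+n<M (ℕ.m≤n⇒m≤1+n (ℕ.<⇒≤ i<n)))))
      (λ eq → ℕ.m>n⇒m∸n≢0 i<n (trans (sym (cong₂ _∸_ (proj₁ input) idx≡)) eq))
      (fillVertex-run {vs = vs} {σ} kf inv)
      (λ {σ′} inv′ → run-map
        (λ { (input″ , filled) → input″ ,
             λ { u (inj₁ d) → filled u (inj₁ (inj₁ d))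
               ; u (inj₂ (here refl)) → filled u (inj₁ (inj₂ refl))
               ; u (inj₂ (there u∈)) → filled u (inj₂ u∈) } })
        (fill-run vs {σ′} kfs inv′))
    where
    i<n : i < n
    i<n = subst (suc i ≤_) len (subst (suc i ≤_) (sym (ℕ.+-suc i (length vs))) (s≤s (ℕ.m≤m+n i _)))

    fits : Fits M σ (var size)
    fits = 0<M , subst (_< M) (sym (proj₁ input)) (1+n<M (ℕ.n≤1+n n))

  Finished : State → Set
  Finished σ = SegmentAt (σ order) 0 (post r) × (∀ u → Filled u σ) ×
    σ result 0 ≡ encode (max (D r S N) (max (D r N N) (D r R N)))

  esiNumberOfTree-run : ∀ {σ} → Input σ → Run M (n + n) esiNumberOfTree σ Finished
  esiNumberOfTree-run {σ} input =
    computePostorder-run {σ} input ⨾ᵣ λ {σ₁} (input₁ , seg) →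
    run-frame (computeTable-run σ₁ input₁ seg) ⨾ᵣ λ {σ₂} (((_ , root≡ , _) , filled) , fr) →
    let cell = λ x → eval-dp {σ₂} {root} {x} {N} r root≡ (filled r x N) (D≤w r x N) (w≤n r)
        eval eq fits _ = eval-max {σ₂} {DP[ root ][ S ][ N ]} (cell S)
                           (eval-max {σ₂} {DP[ root ][ N ][ N ]} {DP[ root ][ R ][ N ]} (cell N) (cell R) (w≤n r)) (w≤n r)
    in run-≔ 0 _ 0<M refl fits eq
         (subst (λ row → SegmentAt row 0 (post r)) (sym (fr order refl)) seg , filled , refl)
    where
    computeTable-run : ∀ σ → Input σ → SegmentAt (σ order) 0 (post r) →
      Run M (n + n) computeTable σ (λ σ′ → Input σ′ × (∀ u → Filled u σ′))
    computeTable-run σ input seg =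
      ((0<M , refl) , (0<M , refl)) ⟶
      run-more iterations-root
        (run-map (λ { (input′ , filled) → input′ , λ u → filled u (inj₂ (∈post-root u)) })
          (fill-run (post r) root-kidsFirst (input , (0 , refl , length-post-root , seg) , λ _ ())))

  -- Here the order of the children ceases to matter: everything computed along `kids` is restated
  -- for `children`.
  isDPTable : ∀ {DP : Table n} → (∀ v x p → DP v x p ≡ D v x p) → IsDPTable T DP
  isDPTable {DP} DP≡ = record
    { typeS      = λ v → trans (unfold v S N) (cong ([ 1 ] ⊹_) (children-sum v (λ c → c N S) (λ u → DP≡ u N S)))
    ; typeR      = λ { v _ (inj₁ refl) → trans (unfold v R N) (R-sum v)
                     ; v _ (inj₂ refl) → trans (unfold v R R) (R-sum v) }
    ; typeN      = λ v p → trans (unfold v N p) (trans (bestOf-maximum D p (kids↭ v))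
        (cong maximum (map-cong (λ a → sumOf-cong a (λ _ → sym (DP≡ _ _ N)))
          (filter (admissible? p) (assignments (children v))))))
    ; impossible = λ v → unfold v S S , unfold v S R , unfold v R S
    }
    where
    open RootedTree T using (children)

    unfold : ∀ v x p → DP v x p ≡ entry x p (map D (kids v))
    unfold v x p = trans (DP≡ v x p) (D-eq v x p)

    children-sum : ∀ v (G : ChildTable → ℕ ₋) {g : Fin n → ℕ ₋} → (∀ u → g u ≡ G (D u)) →
                   sumOf G (map D (kids v)) ≡ sumOf g (children v)
    children-sum v G {g} g≡ = trans (sumOf-map G D (kids v))
      (trans (sumOf-cong (kids v) (λ {u} _ → sym (g≡ u))) (sumOf-↭ g (kids↭ v)))

    R-sum : ∀ v → sumOf (λ c → max (c N R) (c R R)) (map D (kids v)) ≡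
                  sumOf (λ u → max (DP u N R) (DP u R R)) (children v)
    R-sum v = children-sum v _ λ u → cong₂ max (DP≡ u N R) (DP≡ u R R)

  finished⇒completed : ∀ {σ} → Finished σ → Completed T σ
  finished⇒completed {σ} (seg , filled , result≡) = record
    { postorder = post r , postorder r ,
        subst (λ k → applyUpTo (σ order) k ≡ map toℕ (post r)) length-post-root
          (segment⇒applyUpTo (σ order) (λ _ → refl) seg)
    ; table     = isDPTable table≡
    ; returned  = trans (cong decode result≡) (trans (decode-encode _)
        (sym (cong₂ max (table≡ r S N) (cong₂ max (table≡ r N N) (table≡ r R N)))))
    }
    where
    table≡ : ∀ v x p → tableIn σ v x p ≡ D v x p
    table≡ v x p = trans (cong decode (filled v x p)) (decode-encode (D v x p))

theorem22 : ∃[ c ] ∀ {n : ℕ} (T : RootedTree n) (σ : State) → Holds σ T →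
    ∃[ σ′ ] ∃[ t ] Exec (c * n) esiNumberOfTree σ σ′ t × t ≤ c * n
    × Completed T σ′
    × (∃[ α ] decode (σ′ result 0) ≡ [ α ] × IsESINumber (RootedTree.graph T) α)
theorem22 = rate , λ T σ holds →
  let open Holds holds
      open Algorithm T (λ v → proj₁ (childLists v)) (λ v → proj₁ (proj₂ (childLists v))) (room (rootedTree⇒1≤n T))
      run exec time≤ finished = esiNumberOfTree-run {σ} (sizeCell , rootCell , λ v → proj₂ (proj₂ (childLists v)))
      complete = finished⇒completed finished
      open Correctness T _ (Completed.table complete)
      α , output≡ , number = output-correct
  in _ , _ , exec , ℕ.≤-trans time≤ (linear (rootedTree⇒1≤n T)) , complete ,
     α , trans (Completed.returned complete) output≡ , number
  where
  -- One constant must bound the time and supply the memory. Since `n` is positive, the allowance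
  -- `suc (n + n)` is at most `3 * n`, which gives the factor 3; the memory needs `3 + (n + n)`, at
  -- most `5 * n`, and `rate` exceeds 5 by evaluation.
  rate : ℕ
  rate = weight esiNumberOfTree * 3

  3+2n≤5n : ∀ {n} → 1 ≤ n → 3 + (n + n) ≤ 5 * n
  3+2n≤5n {n} 1≤n = begin
    3 + (n + n)     ≤⟨ ℕ.+-monoˡ-≤ (n + n) (ℕ.*-monoʳ-≤ 3 1≤n) ⟩
    3 * n + (n + n) ≡⟨ cong (λ k → 3 * n + (n + k)) (ℕ.+-identityʳ n) ⟨
    3 * n + 2 * n   ≡⟨ ℕ.*-distribʳ-+ n 3 2 ⟨
    5 * n           ∎
    where open ℕ.≤-Reasoning

  room : ∀ {n} → 1 ≤ n → 3 + (n + n) ≤ rate * n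
  room {n} 1≤n = ℕ.≤-trans (3+2n≤5n 1≤n) (ℕ.*-monoˡ-≤ n (ℕ.≤ᵇ⇒≤ 5 rate tt))

  linear : ∀ {n} → 1 ≤ n → weight esiNumberOfTree * suc (n + n) ≤ rate * n
  linear {n} 1≤n = ℕ.≤-trans
    (ℕ.*-monoʳ-≤ (weight esiNumberOfTree)
      (ℕ.+-mono-≤ 1≤n (ℕ.≤-reflexive (cong (n +_) (sym (ℕ.+-identityʳ n))))))
    (ℕ.≤-reflexive (sym (ℕ.*-assoc (weight esiNumberOfTree) 3 n)))
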